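{- Let $p_n=p(n)$ denote the number of partitions of $n$ (with $p_0=1$), let $T_n=\tau(n+1)$ for $n\ge0$, and let $\phi_r=\frac{(-1)^r}{24}|H_r(\overline{T})|$ for $r\ge1$. Then for every integer $n\ge1$: (i) $n!\,p_n=|J_n(\overline{\phi})|$; (ii) $\phi_n=(-1)^{n-1}|H_n(\overline{p})|$; (iii) $p_n=\sum_{|\lambda|=n}z_\lambda^{ -1}\phi_\lambda$, the sum running over all partitions $\lambda$ of $n$.
   Context: $\tau$ is Ramanujan's tau function, defined by $\sum_{n\ge1}\tau(n)q^n=q\prod_{m\ge1}(1-q^m)^{24}$. $|M|$ denotes the determinant of a square matrix $M$. For a sequence $\overline{j}=(j_1,j_2,\dots)$, $J_n(\overline{j})$ is the $n\times n$ matrix whose $(i,k)$ entry is $j_{i-k+1}$ for $1\le k\le i\le n$, is $-i$ for $k=i+1$, and is $0$ for $k>i+1$. For a sequence $\overline{h}=(h_0,h_1,h_2,\dots)$ with $h_0=1$, $H_n(\overline{h})$ is the $n\times n$ matrix whose first column has entries $i\,h_i$ ($1\le i\le n$), whose $(i,k)$ entry is $h_{i-k+1}$ for $2\le k\le i$, is $1$ for $k=i+1$, and is $0$ for $k>i+1$. A partition $\lambda$ is a non-increasing sequence $(\lambda_1,\lambda_2,\dots)$ of non-negative integers with finitely many non-zero terms; $|\lambda|=\sum_i\lambda_i$; $m_k(\lambda)$ is the number of parts of $\lambda$ equal to $k$; $z_\lambda=\prod_{k\ge1}k^{m_k(\lambda)}m_k(\lambda)!$; and $\phi_\lambda=\prod_i\phi_{\lambda_i}$,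 the product being over the positive parts of $\lambda$. -}

module Defs where

open import Data.Bool.Base using (if_then_else_)
open import Data.Fin.Base using (Fin; toℕ; punchIn) renaming (zero to fzero; suc to fsuc)
import Data.Fin.Properties as Fin
open import Data.Integer.Base as ℤ using (ℤ; 0ℤ; 1ℤ)
import Data.Integer.Properties as ℤ
open import Data.List.Base using (List; []; _∷_; _++_; map; foldr; concatMap; replicate; upTo; length)
open import Data.List.Membership.Propositional using (_∈_; find; lose)
open import Data.List.Membership.Propositional.Properties
  using (∈-map⁺; ∈-map⁻; ∈-concatMap⁺; ∈-concatMap⁻; ∈-upTo⁺; ∈-upTo⁻)
open import Data.List.Properties using (++-cancelˡ)
open import Data.List.Relation.Unary.All as All using (All; []; _∷_)
import Data.List.Relation.Unary.All.Properties as All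
open import Data.List.Relation.Unary.AllPairs as AllPairs using (AllPairs; []; _∷_)
import Data.List.Relation.Unary.AllPairs.Properties as AllPairs
open import Data.List.Relation.Unary.Any using (here)
open import Data.List.Relation.Unary.Linked using (Linked)
import Data.List.Relation.Unary.Linked.Properties as Linked
open import Data.List.Relation.Unary.Unique.Propositional using (Unique)
import Data.List.Relation.Unary.Unique.Propositional.Properties as Unique
open import Data.Nat.Base
open import Data.Nat.DivMod using (_/_; m/n*n≤m; m*n/n≡m; /-monoˡ-≤)
open import Data.Nat.ListAction using (sum; product)
open import Data.Nat.ListAction.Properties using (product≢0; sum-++)
import Data.Nat.Properties as ℕ
open import Data.Product.Base using (_×_; _,_; proj₁; proj₂; ∃-syntax)
open import Data.Rational.Base as ℚ using (ℚ; 0ℚ; 1ℚ)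
open import Function.Base using (_$_)
open import Relation.Binary.PropositionalEquality hiding (J)
open import Relation.Nullary using (yes; no; does; contradiction)

import Algebra.Definitions.RawSemiring ℤ.+-*-rawSemiring as ℤΣ
import Algebra.Definitions.RawSemiring ℚ.+-*-rawSemiring as ℚΣ
import Algebra.Properties.Monoid.Sum ℤ.+-0-monoid as ℤSum

PowerSeries : Set
PowerSeries = ℕ → ℤ

q^ : ℕ → PowerSeries
q^ m n = if n ≡ᵇ m then 1ℤ else 0ℤ

infixl 6 _⊖_
infixl 7 _⊛_
infixr 8 _^ˢ_

_⊖_ : PowerSeries → PowerSeries → PowerSeries
(f ⊖ g) n = f n ℤ.- g n

_⊛_ : PowerSeries → PowerSeries → PowerSeries
(f ⊛ g) n = ℤΣ.sum {suc n} λ i → f (toℕ i) ℤ.* g (n ∸ toℕ i)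

_^ˢ_ : PowerSeries → ℕ → PowerSeries
f ^ˢ zero  = q^ 0
f ^ˢ suc k = f ⊛ f ^ˢ k

-- ∏_{m=1}^{N} (1 - q^m)^k
eulerProduct≤ : (k N : ℕ) → PowerSeries
eulerProduct≤ k zero    = q^ 0
eulerProduct≤ k (suc N) = (q^ 0 ⊖ q^ (suc N)) ^ˢ k ⊛ eulerProduct≤ k N

-- The infinite product ∏_{m≥1} (1 - q^m)^k: factors with m > n do not affect
-- the coefficient of q^n (see eulerProduct-stable).
eulerProduct : ℕ → PowerSeries
eulerProduct k n = eulerProduct≤ k n n

τ : ℕ → ℤ
τ = q^ 1 ⊛ eulerProduct 24

module _ where
  private
    _≈⟨_⟩_ : PowerSeries → ℕ → PowerSeries → Set
    f ≈⟨ n ⟩ g = ∀ {i} → i ≤ n → f i ≡ g i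

    ⊛-cong : ∀ {n f f′ g g′} → f ≈⟨ n ⟩ f′ → g ≈⟨ n ⟩ g′ → (f ⊛ g) ≈⟨ n ⟩ (f′ ⊛ g′)
    ⊛-cong f≈f′ g≈g′ {i} i≤n = ℤSum.sum-cong-≗ λ j →
      cong₂ ℤ._*_ (f≈f′ (ℕ.≤-trans (Fin.toℕ≤pred[n] j) i≤n))
                  (g≈g′ (ℕ.≤-trans (ℕ.m∸n≤m i (toℕ j)) i≤n))

    ⊛-identityˡ : ∀ f n → (q^ 0 ⊛ f) n ≡ f n
    ⊛-identityˡ f n = begin
      1ℤ ℤ.* f n ℤ.+ ℤΣ.sum {n} (λ i → 0ℤ ℤ.* f (n ∸ suc (toℕ i)))
        ≡⟨ cong₂ ℤ._+_ (ℤ.*-identityˡ (f n))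
             (ℤSum.sum-replicate-zero n) ⟩
      f n ℤ.+ 0ℤ
        ≡⟨ ℤ.+-identityʳ (f n) ⟩
      f n ∎
      where open ≡-Reasoning

    q^-below : ∀ {i m} → i < m → q^ m i ≡ 0ℤ
    q^-below {zero}  {suc m} _         = refl
    q^-below {suc i} {suc m} (s≤s i<m) = q^-below i<m

    factor≈1 : ∀ {n m} → n < m → (q^ 0 ⊖ q^ m) ≈⟨ n ⟩ q^ 0
    factor≈1 {m = m} n<m {i} i≤n =
      trans (cong (λ x → q^ 0 i ℤ.- x) (q^-below (ℕ.≤-<-trans i≤n n<m)))
            (ℤ.+-identityʳ (q^ 0 i))

    power≈1 : ∀ {n f} k → f ≈⟨ n ⟩ q^ 0 → (f ^ˢ k) ≈⟨ n ⟩ q^ 0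
    power≈1 zero    f≈1     _   = refl
    power≈1 (suc k) f≈1 {i} i≤n =
      trans (⊛-cong f≈1 (power≈1 k f≈1) i≤n) (⊛-identityˡ (q^ 0) i)

    drop-power : ∀ {n m} k f → n < m → ((q^ 0 ⊖ q^ m) ^ˢ k ⊛ f) n ≡ f n
    drop-power {n} {m} k f n<m =
      trans (⊛-cong {f = (q^ 0 ⊖ q^ m) ^ˢ k} {g = f} (power≈1 k (factor≈1 n<m)) (λ _ → refl) ℕ.≤-refl)
            (⊛-identityˡ f n)

  eulerProduct-stable : ∀ k {n N} → n ≤ N → eulerProduct≤ k N n ≡ eulerProduct k n
  eulerProduct-stable k {n} n≤N = go (ℕ.≤⇒≤′ n≤N)
    where
    go : ∀ {N} → n ≤′ N → eulerProduct≤ k N n ≡ eulerProduct k n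
    go ≤′-refl = refl
    go {suc N} (≤′-step n≤′N) =
      trans (drop-power k (eulerProduct≤ k N) (s≤s (ℕ.≤′⇒≤ n≤′N))) (go n≤′N)

-- A partition is represented by the list of its positive parts.
record IsPartition (n : ℕ) (μ : List ℕ) : Set where
  field
    nonIncreasing : Linked _≥_ μ
    positive      : All (0 <_) μ
    total         : sum μ ≡ n

-- The partitions of n with all parts at most k, listed by the
-- multiplicity m of the part k.
partitions≤ : ℕ → ℕ → List (List ℕ)
partitions≤ zero    zero    = [] ∷ []
partitions≤ zero    (suc n) = []
partitions≤ (suc k) n       =
  concatMap (λ m → map (replicate m (suc k) ++_) (partitions≤ k (n ∸ m * suc k)))
            (upTo (suc (n / suc k)))

partitions : ℕ → List (List ℕ)
partitions n = partitions≤ n n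

p : ℕ → ℕ
p n = length (partitions n)

module _ where
  private
    Bounded : ℕ → ℕ → List ℕ → Set
    Bounded k n μ = AllPairs _≥_ μ × All (0 <_) μ × All (_≤ k) μ × sum μ ≡ n

    block : ℕ → ℕ → ℕ → List (List ℕ)
    block k n m = map (replicate m (suc k) ++_) (partitions≤ k (n ∸ m * suc k))

    sum-replicate : ∀ m k → sum (replicate m k) ≡ m * k
    sum-replicate zero    k = refl
    sum-replicate (suc m) k = cong (k +_) (sum-replicate m k)

    m≤n/k : ∀ {m n} k → m * suc k ≤ n → m ≤ n / suc k
    m≤n/k {m} {n} k mk≤n = subst (_≤ n / suc k) (m*n/n≡m m (suc k)) (/-monoˡ-≤ (suc k) mk≤n)

    n/k≥m : ∀ {m n} k → m ≤ n / suc k → m * suc k ≤ n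
    n/k≥m {m} {n} k m≤ = ℕ.≤-trans (ℕ.*-monoˡ-≤ (suc k) m≤) (m/n*n≤m n (suc k))

    All-prefix : ∀ {P : ℕ → Set} {x μ} m → P x → All P μ → All P (replicate m x ++ μ)
    All-prefix m px pμ = All.++⁺ (All.replicate⁺ m px) pμ

    prefix-sorted : ∀ {x μ} m → All (_≤ x) μ → AllPairs _≥_ μ → AllPairs _≥_ (replicate m x ++ μ)
    prefix-sorted zero    _   srt = srt
    prefix-sorted (suc m) all srt = All-prefix m ℕ.≤-refl all ∷ prefix-sorted m all srt

    sound : ∀ k n {μ} → μ ∈ partitions≤ k n → Bounded k n μ
    sound zero    zero (here refl) = [] , [] , [] , refl
    sound (suc k) n μ∈ with find (∈-concatMap⁻ (block k n) {xs = upTo (suc (n / suc k))} μ∈)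
    ... | m , m∈ , μ∈block with ∈-map⁻ (replicate m (suc k) ++_) μ∈block
    ... | ν , ν∈ , refl with sound k (n ∸ m * suc k) ν∈
    ... | srt , pos , bnd , tot =
        prefix-sorted m bnd′ srt
      , All-prefix m z<s pos
      , All-prefix m ℕ.≤-refl bnd′
      , (begin
          sum (replicate m (suc k) ++ ν)       ≡⟨ sum-++ (replicate m (suc k)) ν ⟩
          sum (replicate m (suc k)) + sum ν    ≡⟨ cong₂ _+_ (sum-replicate m (suc k)) tot ⟩
          m * suc k + (n ∸ m * suc k)          ≡⟨ ℕ.m+[n∸m]≡n (n/k≥m k (s≤s⁻¹ (∈-upTo⁻ m∈))) ⟩
          n                                    ∎)
      where
      open ≡-Reasoning
      bnd′ : All (_≤ suc k) ν
      bnd′ = All.map ℕ.m≤n⇒m≤1+n bnd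

    split : ∀ k {μ} → AllPairs _≥_ μ → All (_≤ suc k) μ →
            ∃[ m ] ∃[ ν ] (μ ≡ replicate m (suc k) ++ ν × AllPairs _≥_ ν × All (_≤ k) ν)
    split k []         []         = 0 , [] , refl , [] , []
    split k {x ∷ μ} (x≥ ∷ srt) (x≤ ∷ bnd) with x ℕ.≟ suc k
    ... | no x≢   = 0 , x ∷ μ , refl , x≥ ∷ srt , x≤k ∷ All.map (λ y≤x → ℕ.≤-trans y≤x x≤k) x≥
      where
      x≤k : x ≤ k
      x≤k = s≤s⁻¹ (ℕ.≤∧≢⇒< x≤ x≢)
    ... | yes refl with split k srt bnd
    ...   | m , ν , refl , srt′ , bnd′ = suc m , ν , refl , srt′ , bnd′

    complete : ∀ k n {μ} → Bounded k n μ → μ ∈ partitions≤ k n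
    complete zero    zero    {[]}    _                              = here refl
    complete zero    n       {x ∷ μ} (_ , 0<x ∷ _ , x≤0 ∷ _ , _)    = contradiction x≤0 (ℕ.<⇒≱ 0<x)
    complete (suc k) n       (srt , pos , bnd , tot) with split k srt bnd
    ... | m , ν , refl , srt′ , bnd′ =
        ∈-concatMap⁺ (block k n) $
        lose (∈-upTo⁺ (s≤s (m≤n/k k (ℕ.m+n≤o⇒m≤o _ (ℕ.≤-reflexive tot′))))) $
        ∈-map⁺ (replicate m (suc k) ++_) $
        complete k (n ∸ m * suc k)
          ( srt′ , All.++⁻ʳ (replicate m (suc k)) pos , bnd′
          , trans (sym (ℕ.m+n∸m≡n (m * suc k) (sum ν))) (cong (_∸ m * suc k) tot′))
      where
      tot′ : m * suc k + sum ν ≡ n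
      tot′ = trans (cong (_+ sum ν) (sym (sum-replicate m (suc k))))
                   (trans (sym (sum-++ (replicate m (suc k)) ν)) tot)

    prefix-injective : ∀ {k μ ν} m m′ → All (_≤ k) μ → All (_≤ k) ν →
                       replicate m (suc k) ++ μ ≡ replicate m′ (suc k) ++ ν → m ≡ m′
    prefix-injective zero    zero     _        _        _    = refl
    prefix-injective (suc m) (suc m′) bμ       bν       eq   =
      cong suc (prefix-injective m m′ bμ bν (++-cancelˡ (_ ∷ []) _ _ eq))
    prefix-injective zero    (suc m′) (k<k ∷ _) _       refl = contradiction k<k ℕ.1+n≰n
    prefix-injective (suc m) zero     _        (k<k ∷ _) refl = contradiction k<k ℕ.1+n≰n

    unique : ∀ k n → Unique (partitions≤ k n)
    unique zero    zero    = [] ∷ []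
    unique zero    (suc n) = []
    unique (suc k) n       = Unique.concat⁺
      (All.map⁺ (All.universal (λ m → Unique.map⁺ (++-cancelˡ (replicate m (suc k)) _ _)
                                                  (unique k (n ∸ m * suc k))) _))
      (AllPairs.map⁺ (AllPairs.map disjoint (Unique.upTo⁺ (suc (n / suc k)))))
      where
      disjoint : ∀ {m m′} → m ≢ m′ → ∀ {μ} → μ ∈ block k n m × μ ∈ block k n m′ → _
      disjoint {m} {m′} m≢m′ (μ∈ , μ∈′)
        with ν  , ν∈  , refl ← ∈-map⁻ (replicate m  (suc k) ++_) μ∈
        with ν′ , ν′∈ , eq   ← ∈-map⁻ (replicate m′ (suc k) ++_) μ∈′ =
        m≢m′ (prefix-injective m m′ (bounded ν∈) (bounded ν′∈) eq)
        where
        bounded : ∀ {n ν} → ν ∈ partitions≤ k n → All (_≤ k) ν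
        bounded {n} ν∈ = proj₁ (proj₂ (proj₂ (sound k n ν∈)))

    parts≤sum : ∀ μ → All (_≤ sum μ) μ
    parts≤sum []      = []
    parts≤sum (x ∷ μ) = ℕ.m≤m+n x (sum μ) ∷ All.map (ℕ.m≤n⇒m≤o+n x) (parts≤sum μ)

  ∈-partitions⁻ : ∀ {n μ} → μ ∈ partitions n → IsPartition n μ
  ∈-partitions⁻ {n} μ∈ with sound n n μ∈
  ... | srt , pos , _ , tot = record
    { nonIncreasing = Linked.AllPairs⇒Linked srt ; positive = pos ; total = tot }

  ∈-partitions⁺ : ∀ {n μ} → IsPartition n μ → μ ∈ partitions n
  ∈-partitions⁺ {n} {μ} isP = complete n n
    ( Linked.Linked⇒AllPairs (λ y≤x z≤y → ℕ.≤-trans z≤y y≤x) nonIncreasing , positive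
    , subst (λ s → All (_≤ s) μ) total (parts≤sum μ) , total)
    where open IsPartition isP

  partitions-unique : ∀ n → Unique (partitions n)
  partitions-unique n = unique n n

multiplicity : ℕ → List ℕ → ℕ
multiplicity k []      = 0
multiplicity k (x ∷ μ) = if does (x ℕ.≟ k) then suc (multiplicity k μ) else multiplicity k μ

-- No part of μ exceeds sum μ, so the factors with k > sum μ are all 1.
z : List ℕ → ℕ
z μ = product (map (λ k → k ^ multiplicity k μ * (multiplicity k μ) !) (map suc (upTo (sum μ))))

z-nonZero : ∀ μ → NonZero (z μ)
z-nonZero μ = product≢0 (All.map⁺ (All.map⁺ (All.universal factor≢0 (upTo (sum μ)))))
  where
  factor≢0 : ∀ k → NonZero (suc k ^ multiplicity (suc k) μ * (multiplicity (suc k) μ) !)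
  factor≢0 k = ℕ.m*n≢0 (suc k ^ multiplicity (suc k) μ) ((multiplicity (suc k) μ) !)
    {{ℕ.m^n≢0 (suc k) (multiplicity (suc k) μ)}} {{multiplicity (suc k) μ ℕ.!≢0}}

z⁻¹ : List ℕ → ℚ
z⁻¹ μ = (ℤ.+ 1 ℚ./ z μ) {{z-nonZero μ}}

fromℤ : ℤ → ℚ
fromℤ i = i ℚ./ 1

fromℕ : ℕ → ℚ
fromℕ n = fromℤ (ℤ.+ n)

-1^_ : ℕ → ℚ
-1^ n = (ℚ.- 1ℚ) ℚΣ.^ n

Matrix : ℕ → Set
Matrix n = Fin n → Fin n → ℚ

-- Laplace expansion along the first row.
det : ∀ {n} → Matrix n → ℚ
det {zero}  A = 1ℚ
det {suc n} A = ℚΣ.sum λ j →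
  (-1^ toℕ j) ℚ.* A fzero j ℚ.* det (λ i k → A (fsuc i) (punchIn j k))

-- The entry formulas use the usual indexing from 1.
fromEntries : (ℕ → ℕ → ℚ) → ∀ n → Matrix n
fromEntries a n i k = a (suc (toℕ i)) (suc (toℕ k))

-- The sequence j starts at index 1: the value j 0 is never used.
J-entry : (ℕ → ℚ) → ℕ → ℕ → ℚ
J-entry j i k =
  if does (k ℕ.≤? i) then j (suc i ∸ k) else
  if does (k ℕ.≟ suc i) then ℚ.- fromℕ i else
  0ℚ

J : (n : ℕ) → (ℕ → ℚ) → Matrix n
J n j = fromEntries (J-entry j) n

-- Meant for sequences with h 0 ≡ 1ℚ.
H-entry : (ℕ → ℚ) → ℕ → ℕ → ℚ
H-entry h i k =
  if does (k ℕ.≟ 1) then fromℕ i ℚ.* h i else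
  if does (k ℕ.≤? i) then h (suc i ∸ k) else
  if does (k ℕ.≟ suc i) then 1ℚ else
  0ℚ

H : (n : ℕ) → (ℕ → ℚ) → Matrix n
H n h = fromEntries (H-entry h) n

T : ℕ → ℚ
T n = fromℤ (τ (suc n))

-- Meaningful for r ≥ 1 only; the value φ 0 is never used.
φ : ℕ → ℚ
φ r = (-1^ r) ℚ.* (ℤ.+ 1 ℚ./ 24) ℚ.* det (H r T)

φ[_] : List ℕ → ℚ
φ[ μ ] = foldr ℚ._*_ 1ℚ (map φ μ)

sumOverPartitions : ℕ → (List ℕ → ℚ) → ℚ
sumOverPartitions n f = foldr ℚ._+_ 0ℚ (map f (partitions n))

-- Work in the ring of power series over ℚ with the derivation θ = q d/dq, and let
-- P = Σ p(n) qⁿ.  Each factor of the Euler product cancels one step of the count of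
-- partitions by largest part, so T · P²⁴ = 1.  With L = θP / P this gives θT = -24 L T.
-- For a series f with f(0) = 1 and θf = L f, column operations on the Hessenberg matrices
-- give |J_n(L)| = n! f_n and |H_n(f)| = (-1)^(n-1) L_n; taking f = T shows φ = L, and
-- f = P then yields (i) and (ii).  For (iii), the sum of z_λ⁻¹ φ_λ over partitions with
-- parts ≤ k is the coefficient of qⁿ in ∏_{d≤k} exp(φ_d q^d / d), whose logarithmic
-- derivative agrees with L up to degree k, so the sum agrees with p(n) for n ≤ k.
module Submission where

open import Defs
open import Data.Nat.Base using (ℕ; _≤_; _∸_; _!)
open import Data.Rational.Base using (_*_)
open import Data.Product.Base using (_×_)
open import Relation.Binary.PropositionalEquality using (_≡_)

open import Algebra.Bundles using (CommutativeRing)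
open import Data.Bool.Base using (if_then_else_)
open import Data.Fin.Base using (Fin; toℕ; punchIn) renaming (zero to fzero; suc to fsuc)
open import Data.Integer.Base as ℤ using (1ℤ)
import Data.Integer.Properties as ℤ
open import Data.List.Base
  using (List; []; _∷_; _++_; map; foldr; concatMap; replicate; upTo; length)
open import Data.List.Properties using (map-cong; map-cong-local; map-∘; map-upTo; upTo-∷ʳ; map-++)
open import Data.List.Relation.Unary.All as All using (All; []; _∷_)
import Data.List.Relation.Unary.All.Properties as All
open import Data.Nat.Base as ℕ using (zero; suc; _<_; z≤n; s≤s; NonZero)
open import Data.Nat.DivMod using (_/_; m/n*n≤m; m<n⇒m/n≡0; m/n≡1+[m∸n]/n)
import Data.Nat.Induction as ℕ
open import Data.Nat.ListAction using (sum; product)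
open import Data.Nat.ListAction.Properties using (product-++)
import Data.Nat.Properties as ℕ
import Data.Nat.Solver as ℕ
open import Data.Product.Base using (_,_)
open import Data.Rational.Base as ℚ using (ℚ; 0ℚ; 1ℚ; _+_; -_; _-_)
import Data.Rational.Properties as ℚ
import Data.Rational.Solver as ℚ
open import Data.Rational.Unnormalised.Base as ℚᵘ using (mkℚᵘ; *≡*)
import Data.Rational.Unnormalised.Properties as ℚᵘ
open import Data.Sum.Base using (inj₁; inj₂)
open import Induction.WellFounded using (Acc; acc)
open import Level using (0ℓ)
open import Relation.Binary.PropositionalEquality
  using (_≢_; refl; sym; trans; cong; cong₂; subst; module ≡-Reasoning)
open import Relation.Nullary using (yes; no; does; contradiction)
open import Relation.Nullary.Decidable using (dec-true; dec-false)

import Algebra.Definitions.RawSemiring ℚ.+-*-rawSemiring as ℚΣ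
import Algebra.Properties.Monoid.Sum ℚ.+-0-monoid as ℚSum

open ℚ.+-*-Solver using (solve; _:=_; _:+_; _:*_; :-_; con)
open ℕ.+-*-Solver using () renaming (solve to ℕ-solve; _:=_ to _ℕ:=_; _:*_ to _ℕ:*_)
open ≡-Reasoning

private
  variable
    n : ℕ

-- Embedding ℤ and ℕ into ℚ.

toℚᵘ-fromℤ : ∀ i → ℚ.toℚᵘ (fromℤ i) ℚᵘ.≃ mkℚᵘ i 0
toℚᵘ-fromℤ i = ℚ.toℚᵘ-fromℚᵘ (mkℚᵘ i 0)

fromℤ-+ : ∀ i j → fromℤ (i ℤ.+ j) ≡ fromℤ i + fromℤ j
fromℤ-+ i j = ℚ.toℚᵘ-injective (ℚᵘ.≃-trans (toℚᵘ-fromℤ (i ℤ.+ j)) (ℚᵘ.≃-trans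
  (*≡* (cong (ℤ._* 1ℤ) (sym (cong₂ ℤ._+_ (ℤ.*-identityʳ i) (ℤ.*-identityʳ j)))))
  (ℚᵘ.≃-sym (ℚᵘ.≃-trans (ℚ.toℚᵘ-homo-+ (fromℤ i) (fromℤ j)) (ℚᵘ.+-cong (toℚᵘ-fromℤ i) (toℚᵘ-fromℤ j))))))

fromℤ-* : ∀ i j → fromℤ (i ℤ.* j) ≡ fromℤ i * fromℤ j
fromℤ-* i j = ℚ.toℚᵘ-injective (ℚᵘ.≃-trans (toℚᵘ-fromℤ (i ℤ.* j))
  (ℚᵘ.≃-sym (ℚᵘ.≃-trans (ℚ.toℚᵘ-homo-* (fromℤ i) (fromℤ j)) (ℚᵘ.*-cong (toℚᵘ-fromℤ i) (toℚᵘ-fromℤ j)))))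

fromℤ-neg : ∀ i → fromℤ (ℤ.- i) ≡ - fromℤ i
fromℤ-neg i = ℚ.toℚᵘ-injective (ℚᵘ.≃-trans (toℚᵘ-fromℤ (ℤ.- i))
  (ℚᵘ.≃-sym (ℚᵘ.≃-trans (ℚ.toℚᵘ-homo‿- (fromℤ i)) (ℚᵘ.-‿cong (toℚᵘ-fromℤ i)))))

fromℕ-+ : ∀ m n → fromℕ (m ℕ.+ n) ≡ fromℕ m + fromℕ n
fromℕ-+ m n = fromℤ-+ (ℤ.+ m) (ℤ.+ n)

fromℕ-* : ∀ m n → fromℕ (m ℕ.* n) ≡ fromℕ m * fromℕ n
fromℕ-* m n = trans (cong fromℤ (ℤ.pos-* m n)) (fromℤ-* (ℤ.+ m) (ℤ.+ n))

fromℕ-suc : ∀ n → fromℕ (suc n) ≡ 1ℚ + fromℕ n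
fromℕ-suc = fromℕ-+ 1

recip : ∀ n → .{{NonZero n}} → ℚ
recip n = ℤ.+ 1 ℚ./ n

fromℕ-*-recip : ∀ n .{{_ : NonZero n}} → fromℕ n * recip n ≡ 1ℚ
fromℕ-*-recip n@(suc k) = ℚ.toℚᵘ-injective (ℚᵘ.≃-trans (ℚ.toℚᵘ-homo-* (fromℕ n) (recip n))
  (ℚᵘ.≃-trans (ℚᵘ.*-cong (toℚᵘ-fromℤ (ℤ.+ n)) (ℚ.toℚᵘ-fromℚᵘ (mkℚᵘ 1ℤ k)))
  (*≡* (trans (trans (ℤ.*-identityʳ _) (ℤ.*-identityʳ (ℤ.+ n)))
              (sym (trans (ℤ.*-identityˡ _) (cong ℤ.+_ (ℕ.*-identityˡ n))))))))

fromℕ-cancelˡ : ∀ n .{{_ : NonZero n}} {x y} → fromℕ n * x ≡ fromℕ n * y → x ≡ y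
fromℕ-cancelˡ n {x} {y} eq = trans (sym (undo x)) (trans (cong (recip n *_) eq) (undo y))
  where
  undo : ∀ x → recip n * (fromℕ n * x) ≡ x
  undo x = trans (solve 3 (λ a b x → a :* (b :* x) := (b :* a) :* x) refl (recip n) (fromℕ n) x)
                 (trans (cong (_* x) (fromℕ-*-recip n)) (ℚ.*-identityˡ x))

-- The ring of power series over ℚ and its derivation.

Series : Set
Series = ℕ → ℚ

infix 4 _≈_
_≈_ : Series → Series → Set
f ≈ g = ∀ n → f n ≡ g n

tail : Series → Series
tail f n = f (suc n)

infixl 6 _⊕_
infixl 7 _✶_
infixr 7 _·_

_⊕_ : Series → Series → Series
(f ⊕ g) n = f n + g n

⊝_ : Series → Series
(⊝ f) n = - f n

_·_ : ℚ → Series → Series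
(c · f) n = c * f n

𝟘 : Series
𝟘 _ = 0ℚ

𝟙 : Series
𝟙 zero    = 1ℚ
𝟙 (suc _) = 0ℚ

-- This recursion on the degree is the first-order form of the Cauchy product:
-- tail (f ✶ g) = f 0 · tail g ⊕ tail f ✶ g.
_✶_ : Series → Series → Series
(f ✶ g) zero    = f 0 * g 0
(f ✶ g) (suc n) = f 0 * g (suc n) + (tail f ✶ g) n

-- Euler's operator q d/dq.
θ : Series → Series
θ f n = fromℕ n * f n

-- Degree `n` of a product sees its factors only up to degree `n`; this lets truncated series stand
-- in for full ones below.
✶-cong≤ : ∀ n {f f′ g g′} → (∀ {i} → i ≤ n → f i ≡ f′ i) → (∀ {i} → i ≤ n → g i ≡ g′ i) →
          (f ✶ g) n ≡ (f′ ✶ g′) n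
✶-cong≤ zero    f≡ g≡ = cong₂ _*_ (f≡ z≤n) (g≡ z≤n)
✶-cong≤ (suc n) f≡ g≡ = cong₂ _+_ (cong₂ _*_ (f≡ z≤n) (g≡ ℕ.≤-refl))
  (✶-cong≤ n (λ i≤n → f≡ (s≤s i≤n)) (λ i≤n → g≡ (ℕ.m≤n⇒m≤1+n i≤n)))

✶-cong : ∀ {f f′ g g′} → f ≈ f′ → g ≈ g′ → f ✶ g ≈ f′ ✶ g′
✶-cong f≈ g≈ n = ✶-cong≤ n (λ {i} _ → f≈ i) (λ {i} _ → g≈ i)

✶-zeroˡ : ∀ g → 𝟘 ✶ g ≈ 𝟘
✶-zeroˡ g zero    = ℚ.*-zeroˡ (g 0)
✶-zeroˡ g (suc n) = trans (cong₂ _+_ (ℚ.*-zeroˡ (g (suc n))) (✶-zeroˡ g n)) (ℚ.+-identityˡ 0ℚ)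

✶-identityˡ : ∀ g → 𝟙 ✶ g ≈ g
✶-identityˡ g zero    = ℚ.*-identityˡ (g 0)
✶-identityˡ g (suc n) =
  trans (cong₂ _+_ (ℚ.*-identityˡ (g (suc n))) (✶-zeroˡ g n)) (ℚ.+-identityʳ _)

✶-distribʳ : ∀ g f f′ → (f ⊕ f′) ✶ g ≈ f ✶ g ⊕ f′ ✶ g
✶-distribʳ g f f′ zero    = ℚ.*-distribʳ-+ (g 0) (f 0) (f′ 0)
✶-distribʳ g f f′ (suc n) = trans
  (cong ((f 0 + f′ 0) * g (suc n) +_) (✶-distribʳ g (tail f) (tail f′) n))
  (solve 5 (λ a b c x y → (a :+ b) :* c :+ (x :+ y) := (a :* c :+ x) :+ (b :* c :+ y)) refl
    (f 0) (f′ 0) (g (suc n)) ((tail f ✶ g) n) ((tail f′ ✶ g) n))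

·-✶-assoc : ∀ c f g → (c · f) ✶ g ≈ c · (f ✶ g)
·-✶-assoc c f g zero    = ℚ.*-assoc c (f 0) (g 0)
·-✶-assoc c f g (suc n) = trans
  (cong (c * f 0 * g (suc n) +_) (·-✶-assoc c (tail f) g n))
  (solve 4 (λ c a b x → c :* a :* b :+ c :* x := c :* (a :* b :+ x)) refl
    c (f 0) (g (suc n)) ((tail f ✶ g) n))

✶-assoc : ∀ f g h → (f ✶ g) ✶ h ≈ f ✶ (g ✶ h)
✶-assoc f g h zero    = ℚ.*-assoc (f 0) (g 0) (h 0)
✶-assoc f g h (suc n) = begin
  f 0 * g 0 * h (suc n) + ((f 0 · tail g ⊕ tail f ✶ g) ✶ h) n
    ≡⟨ cong (f 0 * g 0 * h (suc n) +_) (trans (✶-distribʳ h (f 0 · tail g) (tail f ✶ g) n)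
         (cong₂ _+_ (·-✶-assoc (f 0) (tail g) h n) (✶-assoc (tail f) g h n))) ⟩
  f 0 * g 0 * h (suc n) + (f 0 * (tail g ✶ h) n + (tail f ✶ (g ✶ h)) n)
    ≡⟨ solve 5 (λ a b c x y → a :* b :* c :+ (a :* x :+ y) := a :* (b :* c :+ x) :+ y) refl
         (f 0) (g 0) (h (suc n)) ((tail g ✶ h) n) ((tail f ✶ (g ✶ h)) n) ⟩
  f 0 * (g 0 * h (suc n) + (tail g ✶ h) n) + (tail f ✶ (g ✶ h)) n ∎

-- The induction strips the leading coefficient from both factors and lands two degrees lower, at
-- `tail f ✶ tail g`; in degree 1 nothing remains there, hence the separate case.
✶-comm : ∀ f g → f ✶ g ≈ g ✶ f
✶-comm f g zero          = ℚ.*-comm (f 0) (g 0)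
✶-comm f g (suc zero)    =
  solve 4 (λ a b c d → a :* d :+ b :* c := c :* b :+ d :* a) refl (f 0) (f 1) (g 0) (g 1)
✶-comm f g (suc (suc n)) = begin
  f 0 * g (2 ℕ.+ n) + (tail f ✶ g) (suc n)
    ≡⟨ cong (f 0 * g (2 ℕ.+ n) +_) (✶-comm (tail f) g (suc n)) ⟩
  f 0 * g (2 ℕ.+ n) + (g 0 * f (2 ℕ.+ n) + (tail g ✶ tail f) n)
    ≡⟨ cong (λ x → f 0 * g (2 ℕ.+ n) + (g 0 * f (2 ℕ.+ n) + x)) (✶-comm (tail g) (tail f) n) ⟩
  f 0 * g (2 ℕ.+ n) + (g 0 * f (2 ℕ.+ n) + (tail f ✶ tail g) n)
    ≡⟨ solve 3 (λ x y z → x :+ (y :+ z) := y :+ (x :+ z)) refl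
         (f 0 * g (2 ℕ.+ n)) (g 0 * f (2 ℕ.+ n)) ((tail f ✶ tail g) n) ⟩
  g 0 * f (2 ℕ.+ n) + (f ✶ tail g) (suc n)
    ≡⟨ cong (g 0 * f (2 ℕ.+ n) +_) (✶-comm f (tail g) (suc n)) ⟩
  g 0 * f (2 ℕ.+ n) + (tail g ✶ f) (suc n) ∎

seriesRing : CommutativeRing 0ℓ 0ℓ
seriesRing = record
  { Carrier = Series ; _≈_ = _≈_ ; _+_ = _⊕_ ; _*_ = _✶_ ; -_ = ⊝_ ; 0# = 𝟘 ; 1# = 𝟙
  ; isCommutativeRing = record
    { isRing = record
      { +-isAbelianGroup = record
        { isGroup = record
          { isMonoid = record
            { isSemigroup = record
              { isMagma = record
                { isEquivalence = record
                  { refl = λ _ → refl ; sym = λ f≈g n → sym (f≈g n)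
                  ; trans = λ f≈g g≈h n → trans (f≈g n) (g≈h n) }
                ; ∙-cong = λ f≈ g≈ n → cong₂ _+_ (f≈ n) (g≈ n) }
              ; assoc = λ f g h n → ℚ.+-assoc (f n) (g n) (h n) }
            ; identity = (λ f n → ℚ.+-identityˡ (f n)) , (λ f n → ℚ.+-identityʳ (f n)) }
          ; inverse = (λ f n → ℚ.+-inverseˡ (f n)) , (λ f n → ℚ.+-inverseʳ (f n))
          ; ⁻¹-cong = λ f≈ n → cong -_ (f≈ n) }
        ; comm = λ f g n → ℚ.+-comm (f n) (g n) }
      ; *-cong = ✶-cong
      ; *-assoc = ✶-assoc
      ; *-identity = ✶-identityˡ , λ f n → trans (✶-comm f 𝟙 n) (✶-identityˡ f n)
      ; distrib = (λ f g h n → trans (✶-comm f (g ⊕ h) n)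
                    (trans (✶-distribʳ f g h n) (cong₂ _+_ (✶-comm g f n) (✶-comm h f n))))
                , ✶-distribʳ }
    ; *-comm = ✶-comm } }

module S = CommutativeRing seriesRing

open import Algebra.Properties.CommutativeSemigroup S.*-commutativeSemigroup using (x∙yz≈y∙xz; x∙yz≈xz∙y; xy∙z≈y∙xz)
open import Algebra.Properties.Ring S.ring using (-‿distribˡ-*)
open import Algebra.Properties.Group S.+-group using (inverseˡ-unique)
open import Algebra.Properties.CommutativeSemiring.Exp S.commutativeSemiring using (_^_; ^-congˡ; ^-distrib-*)

-- Induction on the degree: the summand 1 in `fromℕ (suc n)` gives an extra `tail f ✶ g`, which is
-- absorbed by `tail-θ`.
θ-✶ : ∀ f g → θ (f ✶ g) ≈ θ f ✶ g ⊕ f ✶ θ g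
θ-✶ f g zero    =
  solve 2 (λ a b → con 0ℚ :* (a :* b) := con 0ℚ :* a :* b :+ a :* (con 0ℚ :* b)) refl (f 0) (g 0)
θ-✶ f g (suc n) = begin
  fromℕ (suc n) * (f 0 * g (suc n) + (tail f ✶ g) n)
    ≡⟨ solve 4 (λ s a b x → s :* (a :* b :+ x) := s :* (a :* b) :+ s :* x) refl
         (fromℕ (suc n)) (f 0) (g (suc n)) ((tail f ✶ g) n) ⟩
  fromℕ (suc n) * (f 0 * g (suc n)) + fromℕ (suc n) * (tail f ✶ g) n
    ≡⟨ cong (λ s → fromℕ (suc n) * (f 0 * g (suc n)) + s * (tail f ✶ g) n) (fromℕ-suc n) ⟩
  fromℕ (suc n) * (f 0 * g (suc n)) + (1ℚ + fromℕ n) * (tail f ✶ g) n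
    ≡⟨ cong (fromℕ (suc n) * (f 0 * g (suc n)) +_)
         (solve 2 (λ s x → (con 1ℚ :+ s) :* x := x :+ s :* x) refl (fromℕ n) ((tail f ✶ g) n)) ⟩
  fromℕ (suc n) * (f 0 * g (suc n)) + ((tail f ✶ g) n + θ (tail f ✶ g) n)
    ≡⟨ cong (λ y → fromℕ (suc n) * (f 0 * g (suc n)) + ((tail f ✶ g) n + y)) (θ-✶ (tail f) g n) ⟩
  fromℕ (suc n) * (f 0 * g (suc n)) + ((tail f ✶ g) n + ((θ (tail f) ✶ g) n + (tail f ✶ θ g) n))
    ≡⟨ solve 6 (λ s a b x y z → s :* (a :* b) :+ (x :+ (y :+ z)) :=
                                con 0ℚ :* a :* b :+ (x :+ y) :+ (a :* (s :* b) :+ z)) refl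
         (fromℕ (suc n)) (f 0) (g (suc n)) ((tail f ✶ g) n) ((θ (tail f) ✶ g) n) ((tail f ✶ θ g) n) ⟩
  0ℚ * f 0 * g (suc n) + ((tail f ✶ g) n + (θ (tail f) ✶ g) n) + (f ✶ θ g) (suc n)
    ≡⟨ cong (λ y → 0ℚ * f 0 * g (suc n) + y + (f ✶ θ g) (suc n)) (✶-distribʳ g (tail f) (θ (tail f)) n) ⟨
  0ℚ * f 0 * g (suc n) + ((tail f ⊕ θ (tail f)) ✶ g) n + (f ✶ θ g) (suc n)
    ≡⟨ cong (λ y → 0ℚ * f 0 * g (suc n) + y + (f ✶ θ g) (suc n)) (✶-cong tail-θ (λ _ → refl) n) ⟨
  (θ f ✶ g) (suc n) + (f ✶ θ g) (suc n) ∎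
  where
  tail-θ : tail (θ f) ≈ tail f ⊕ θ (tail f)
  tail-θ i = trans (cong (_* f (suc i)) (fromℕ-suc i))
    (solve 2 (λ s x → (con 1ℚ :+ s) :* x := x :+ s :* x) refl (fromℕ i) (f (suc i)))

-- Determinants of Hessenberg matrices.

det-cong : {A B : Matrix n} → (∀ i k → A i k ≡ B i k) → det A ≡ det B
det-cong {zero}  _   = refl
det-cong {suc n} A≡B = ℚSum.sum-cong-≗ λ j →
  cong₂ _*_ (cong ((-1^ toℕ j) *_) (A≡B fzero j)) (det-cong λ i k → A≡B (fsuc i) (punchIn j k))

-- Indexed from 0: first column c, superdiagonal u, and h along the diagonals of the
-- remaining columns.
hess : (u c h : Series) → ℕ → ℕ → ℚ
hess u c h i       zero          = c i
hess u c h zero    (suc zero)    = u 0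
hess u c h zero    (suc (suc k)) = 0ℚ
hess u c h (suc i) (suc k)       = hess (tail u) h h i k

hessMatrix : (u c h : Series) → ∀ n → Matrix n
hessMatrix u c h n i k = hess u c h (toℕ i) (toℕ k)

hess-suc-column : ∀ u c c′ h i k → hess u c h i (suc k) ≡ hess u c′ h i (suc k)
hess-suc-column u c c′ h zero    zero    = refl
hess-suc-column u c c′ h zero    (suc k) = refl
hess-suc-column u c c′ h (suc i) k       = refl

-- Bridges the conditional entries of `J` and `H` to the recursion along diagonals; the tests agree
-- by computation with those of `J-entry` and `H-entry` in row `i + 1` and column `k + 2`.
hess-entry : ∀ u c h i k → hess u c (tail h) i (suc k) ≡
  (if does (suc (suc k) ℕ.≤? suc i) then h (i ∸ k) else
   if does (k ℕ.≟ i) then u i else 0ℚ)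
hess-entry u c h zero    zero    = refl
hess-entry u c h zero    (suc k) = refl
hess-entry u c h (suc i) zero    = refl
hess-entry u c h (suc i) (suc k) = hess-entry (tail u) (tail h) h i k

-- Only the first two entries of the top row can be nonzero. Deleting the first column exposes `h`
-- as the new first column; deleting the second leaves `tail c` there.
det-hess-expand : ∀ u c h n → det (hessMatrix u c h (2 ℕ.+ n)) ≡
  c 0 * det (hessMatrix (tail u) h h (suc n)) - u 0 * det (hessMatrix (tail u) (tail c) h (suc n))
det-hess-expand u c h n = begin
  1ℚ * c 0 * D₀ + ((- 1ℚ) * 1ℚ * u 0 * D₁ + ℚΣ.sum {n} rest)
    ≡⟨ cong₂ (λ x y → 1ℚ * c 0 * D₀ + ((- 1ℚ) * 1ℚ * u 0 * x + y)) D₁≡ rest≡0 ⟩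
  1ℚ * c 0 * D₀ + ((- 1ℚ) * 1ℚ * u 0 * D₁′ + 0ℚ)
    ≡⟨ solve 4 (λ c d u d′ → con 1ℚ :* c :* d :+ (con (- 1ℚ) :* con 1ℚ :* u :* d′ :+ con 0ℚ)
                             := c :* d :+ :- (u :* d′)) refl (c 0) D₀ (u 0) D₁′ ⟩
  c 0 * D₀ - u 0 * D₁′ ∎
  where
  A : Matrix (2 ℕ.+ n)
  A = hessMatrix u c h (2 ℕ.+ n)
  minor : Fin (2 ℕ.+ n) → Matrix (suc n)
  minor j i k = A (fsuc i) (punchIn j k)
  D₀ D₁ D₁′ : ℚ
  D₀ = det (minor fzero)
  D₁ = det (minor (fsuc fzero))
  D₁′ = det (hessMatrix (tail u) (tail c) h (suc n))
  rest : Fin n → ℚ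
  rest j = (-1^ (2 ℕ.+ toℕ j)) * 0ℚ * det (minor (fsuc (fsuc j)))
  D₁≡ : D₁ ≡ D₁′
  D₁≡ = det-cong {A = minor (fsuc fzero)} {B = hessMatrix (tail u) (tail c) h (suc n)} λ where
    i fzero    → refl
    i (fsuc k) → hess-suc-column (tail u) h (tail c) h (toℕ i) (toℕ k)
  rest≡0 : ℚΣ.sum rest ≡ 0ℚ
  rest≡0 = trans
    (ℚSum.sum-cong-≗ λ j → solve 2 (λ s d → s :* con 0ℚ :* d := con 0ℚ) refl
      (-1^ (2 ℕ.+ toℕ j)) (det (minor (fsuc (fsuc j)))))
    (ℚSum.sum-replicate-zero n)

Π : Series → ℕ → ℚ
Π v zero    = 1ℚ
Π v (suc n) = v 0 * Π (tail v) n

-- Add x₀ times the second column to the first: all that survives in the top row is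
-- the entry - v₀ above the diagonal, and the remaining minor is of the same shape.
det-hess : ∀ n v c h x → v 0 * x 0 ≡ c 0 → (∀ s → v (suc s) * x (suc s) ≡ c (suc s) + (x ✶ h) s) →
           det (hessMatrix (⊝ v) c h (suc n)) ≡ Π v (suc n) * x n
det-hess zero v c h x head _ = begin
  1ℚ * c 0 * 1ℚ + 0ℚ
    ≡⟨ solve 1 (λ c → con 1ℚ :* c :* con 1ℚ :+ con 0ℚ := c) refl (c 0) ⟩
  c 0
    ≡⟨ head ⟨
  v 0 * x 0
    ≡⟨ cong (_* x 0) (ℚ.*-identityʳ (v 0)) ⟨
  v 0 * 1ℚ * x 0 ∎
det-hess (suc n) v c h x head rec = begin
  det (hessMatrix (⊝ v) c h (2 ℕ.+ n))
    ≡⟨ det-hess-expand (⊝ v) c h n ⟩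
  c 0 * D h - (- v 0) * D (tail c)
    ≡⟨ cong (λ y → y * D h - (- v 0) * D (tail c)) head ⟨
  v 0 * x 0 * D h - (- v 0) * D (tail c)
    ≡⟨ solve 4 (λ v x d e → v :* x :* d :+ :- (:- v :* e) := v :* (x :* d :+ e)) refl
         (v 0) (x 0) (D h) (D (tail c)) ⟩
  v 0 * (x 0 * D h + D (tail c))
    -- The two minors differ only in their first column, so linearity in that column performs the
    -- column operation.
    ≡⟨ cong (v 0 *_) (det-linear n (x 0) h (tail c)) ⟨
  v 0 * D (x 0 · h ⊕ tail c)
    ≡⟨ cong (v 0 *_) (det-hess n (tail v) (x 0 · h ⊕ tail c) h (tail x) head′ rec′) ⟩
  v 0 * (Π (tail v) (suc n) * x (suc n))
    ≡⟨ ℚ.*-assoc (v 0) (Π (tail v) (suc n)) (x (suc n)) ⟨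
  Π v (2 ℕ.+ n) * x (suc n) ∎
  where
  D : Series → ℚ
  D b = det (hessMatrix (⊝ tail v) b h (suc n))
  det-linear : ∀ n {u} s b b′ → det (hessMatrix u (s · b ⊕ b′) h (suc n)) ≡
               s * det (hessMatrix u b h (suc n)) + det (hessMatrix u b′ h (suc n))
  det-linear zero s b b′ = solve 3
    (λ s b b′ → con 1ℚ :* (s :* b :+ b′) :* con 1ℚ :+ con 0ℚ :=
                s :* (con 1ℚ :* b :* con 1ℚ :+ con 0ℚ) :+ (con 1ℚ :* b′ :* con 1ℚ :+ con 0ℚ))
    refl s (b 0) (b′ 0)
  det-linear (suc n) {u} s b b′ = begin
    det (hessMatrix u (s · b ⊕ b′) h (2 ℕ.+ n))
      ≡⟨ det-hess-expand u (s · b ⊕ b′) h n ⟩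
    (s * b 0 + b′ 0) * M - u 0 * det (hessMatrix (tail u) (s · tail b ⊕ tail b′) h (suc n))
      ≡⟨ cong (λ y → (s * b 0 + b′ 0) * M - u 0 * y) (det-linear n s (tail b) (tail b′)) ⟩
    (s * b 0 + b′ 0) * M - u 0 * (s * N (tail b) + N (tail b′))
      ≡⟨ solve 7 (λ s b b′ m u e e′ → (s :* b :+ b′) :* m :+ :- (u :* (s :* e :+ e′)) :=
                   s :* (b :* m :+ :- (u :* e)) :+ (b′ :* m :+ :- (u :* e′))) refl
           s (b 0) (b′ 0) M (u 0) (N (tail b)) (N (tail b′)) ⟩
    s * (b 0 * M - u 0 * N (tail b)) + (b′ 0 * M - u 0 * N (tail b′))
      ≡⟨ cong₂ (λ y z → s * y + z) (det-hess-expand u b h n) (det-hess-expand u b′ h n) ⟨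
    s * det (hessMatrix u b h (2 ℕ.+ n)) + det (hessMatrix u b′ h (2 ℕ.+ n)) ∎
    where
    M : ℚ
    M = det (hessMatrix (tail u) h h (suc n))
    N : Series → ℚ
    N c = det (hessMatrix (tail u) c h (suc n))
  head′ : v 1 * x 1 ≡ x 0 * h 0 + c 1
  head′ = trans (rec 0) (ℚ.+-comm (c 1) (x 0 * h 0))
  rec′ : ∀ s → v (2 ℕ.+ s) * x (2 ℕ.+ s) ≡ x 0 * h (suc s) + c (2 ℕ.+ s) + (tail x ✶ h) s
  rec′ s = trans (rec (suc s))
    (solve 3 (λ a b y → a :+ (b :+ y) := b :+ a :+ y) refl
      (c (2 ℕ.+ s)) (x 0 * h (suc s)) ((tail x ✶ h) s))

Π-snoc : ∀ v n → Π v (suc n) ≡ v n * Π v n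
Π-snoc v zero    = refl
Π-snoc v (suc n) = trans (cong (v 0 *_) (Π-snoc (tail v) n))
  (solve 3 (λ a b x → a :* (b :* x) := b :* (a :* x)) refl (v 0) (v (suc n)) (Π (tail v) n))

Π-! : ∀ n → Π (λ i → fromℕ (suc i)) n ≡ fromℕ (n !)
Π-! zero    = refl
Π-! (suc n) = trans (Π-snoc (λ i → fromℕ (suc i)) n)
  (trans (cong (fromℕ (suc n) *_) (Π-! n)) (sym (fromℕ-* (suc n) (n !))))

Π--1 : ∀ n → Π (λ _ → - 1ℚ) n ≡ -1^ n
Π--1 zero    = refl
Π--1 (suc n) = cong ((- 1ℚ) *_) (Π--1 n)

-- Logarithmic derivatives and Newton's identities.

record IsLogDerivative (L f : Series) : Set where
  field
    vanish : L 0 ≡ 0ℚ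
    deriv  : θ f ≈ L ✶ f

  -- With the `L 0` term gone, the right-hand side involves `f` only up to degree `s`: a recursion
  -- for the coefficients.
  deriv-suc : ∀ s → fromℕ (suc s) * f (suc s) ≡ (tail L ✶ f) s
  deriv-suc s = trans (deriv (suc s))
    (trans (cong (λ l → l * f (suc s) + (tail L ✶ f) s) vanish)
    (trans (cong (_+ (tail L ✶ f) s) (ℚ.*-zeroˡ (f (suc s)))) (ℚ.+-identityˡ _)))

module _ {L f : Series} (f0≡1 : f 0 ≡ 1ℚ) (logDeriv : IsLogDerivative L f) where
  open IsLogDerivative logDeriv

  newton₁ : fromℕ 1 * f 1 ≡ L 1
  newton₁ = trans (deriv-suc 0) (trans (cong (L 1 *_) f0≡1) (ℚ.*-identityʳ (L 1)))

  -- These are Newton's identities, with `f` as complete homogeneous functions and `L` as power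
  -- sums. The term with `f 0` is split off to fit the hypotheses of `det-hess`.
  newton : ∀ s → fromℕ (2 ℕ.+ s) * f (2 ℕ.+ s) ≡ L (2 ℕ.+ s) + (tail f ✶ tail L) s
  newton s = trans (deriv-suc (suc s)) (trans (✶-comm (tail L) f (suc s))
    (cong (_+ (tail f ✶ tail L) s)
      (trans (cong (_* L (2 ℕ.+ s)) f0≡1) (ℚ.*-identityˡ (L (2 ℕ.+ s))))))

  -- Newton's identities are a triangular system for `tail f` with pivots 1, 2, 3, ..., and with
  -- `tail L` both as first column and along the diagonals. `det-hess` reads off the last unknown;
  -- the pivots multiply to the factorial.
  det-J : ∀ j → tail j ≈ tail L → ∀ n → det (J (suc n) j) ≡ fromℕ (suc n !) * f (suc n)
  det-J j j≈L n = begin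
    det (J (suc n) j)
      ≡⟨ det-cong {A = J (suc n) j} {B = hessMatrix (⊝ v) (tail j) (tail j) (suc n)} (λ where
           i fzero    → refl
           i (fsuc k) → sym (hess-entry (⊝ v) (tail j) j (toℕ i) (toℕ k))) ⟩
    det (hessMatrix (⊝ v) (tail j) (tail j) (suc n))
      ≡⟨ det-hess n v (tail j) (tail j) (tail f) (trans newton₁ (sym (j≈L 0)))
           (λ s → trans (newton s) (cong₂ _+_ (sym (j≈L (suc s)))
             (✶-cong {f = tail f} S.refl (S.sym j≈L) s))) ⟩
    Π v (suc n) * f (suc n)
      ≡⟨ cong (_* f (suc n)) (Π-! (suc n)) ⟩
    fromℕ (suc n !) * f (suc n) ∎
    where
    v : Series
    v i = fromℕ (suc i)

  -- The same identities solved for `L`: the unknown is `- L`, all pivots are `- 1ℚ`, the first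
  -- column comes from `θ f` and the diagonals from `f`.
  det-H : ∀ n → det (H (suc n) f) ≡ (-1^ n) * L (suc n)
  det-H n = begin
    det (H (suc n) f)
      ≡⟨ det-cong {A = H (suc n) f} {B = hessMatrix (⊝ v) (tail (θ f)) (tail f) (suc n)} (λ where
           i fzero    → refl
           i (fsuc k) → sym (hess-entry (⊝ v) (tail (θ f)) f (toℕ i) (toℕ k))) ⟩
    det (hessMatrix (⊝ v) (tail (θ f)) (tail f) (suc n))
      ≡⟨ det-hess n v (tail (θ f)) (tail f) (tail (⊝ L)) head rec ⟩
    Π v (suc n) * - L (suc n)
      ≡⟨ cong (_* - L (suc n)) (Π--1 (suc n)) ⟩
    (- 1ℚ) * (-1^ n) * - L (suc n)
      ≡⟨ solve 2 (λ s l → con (- 1ℚ) :* s :* :- l := s :* l) refl (-1^ n) (L (suc n)) ⟩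
    (-1^ n) * L (suc n) ∎
    where
    v : Series
    v _ = - 1ℚ
    neg : ∀ l → (- 1ℚ) * - l ≡ l
    neg = solve 1 (λ l → con (- 1ℚ) :* :- l := l) refl
    head : (- 1ℚ) * - L 1 ≡ fromℕ 1 * f 1
    head = trans (neg (L 1)) (sym newton₁)
    ⊝-tail : ⊝ tail L ≈ (- 1ℚ) · tail L
    ⊝-tail i = solve 1 (λ l → :- l := con (- 1ℚ) :* l) refl (L (suc i))
    rec : ∀ s → (- 1ℚ) * - L (2 ℕ.+ s) ≡ θ f (2 ℕ.+ s) + ((⊝ tail L) ✶ tail f) s
    rec s = begin
      (- 1ℚ) * - L (2 ℕ.+ s)
        -- The convolution is added and subtracted; the positive copy completes the right-hand side
        -- of `newton`.
        ≡⟨ solve 2 (λ l y → con (- 1ℚ) :* :- l := l :+ y :+ con (- 1ℚ) :* y) refl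
             (L (2 ℕ.+ s)) ((tail f ✶ tail L) s) ⟩
      L (2 ℕ.+ s) + (tail f ✶ tail L) s + (- 1ℚ) * (tail f ✶ tail L) s
        ≡⟨ cong₂ (λ x y → x + (- 1ℚ) * y) (sym (newton s)) (✶-comm (tail f) (tail L) s) ⟩
      θ f (2 ℕ.+ s) + (- 1ℚ) * (tail L ✶ tail f) s
        ≡⟨ cong (θ f (2 ℕ.+ s) +_) (trans (sym (·-✶-assoc (- 1ℚ) (tail L) (tail f) s))
             (✶-cong {f = (- 1ℚ) · tail L} {g = tail f} (S.sym ⊝-tail) S.refl s)) ⟩
      θ f (2 ℕ.+ s) + ((⊝ tail L) ✶ tail f) s ∎

-- `deriv-suc` fixes each coefficient from lower ones after division by the degree. The bound `n`
-- matters because a truncated logarithmic derivative will be compared with a full one.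
logDerivative-unique : ∀ {L M f g} → f 0 ≡ g 0 → IsLogDerivative L f → IsLogDerivative M g →
  ∀ n → (∀ {i} → i ≤ n → L i ≡ M i) → ∀ {i} → i ≤ n → f i ≡ g i
logDerivative-unique f0≡g0 Lf Mg zero    L≡M z≤n = f0≡g0
logDerivative-unique {L} {M} {f} {g} f0≡g0 Lf Mg (suc n) L≡M i≤1+n with ℕ.m≤n⇒m<n∨m≡n i≤1+n
... | inj₁ (s≤s i≤n) = logDerivative-unique f0≡g0 Lf Mg n (λ j≤n → L≡M (ℕ.m≤n⇒m≤1+n j≤n)) i≤n
... | inj₂ refl      = fromℕ-cancelˡ (suc n) (begin
  fromℕ (suc n) * f (suc n)
    ≡⟨ IsLogDerivative.deriv-suc Lf n ⟩
  (tail L ✶ f) n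
    ≡⟨ ✶-cong≤ n (λ j≤n → L≡M (s≤s j≤n))
         (logDerivative-unique f0≡g0 Lf Mg n (λ j≤n → L≡M (ℕ.m≤n⇒m≤1+n j≤n))) ⟩
  (tail M ✶ g) n
    ≡⟨ IsLogDerivative.deriv-suc Mg n ⟨
  fromℕ (suc n) * g (suc n) ∎)

-- Sums over lists.

total : {A : Set} → (A → ℚ) → List A → ℚ
total f xs = foldr _+_ 0ℚ (map f xs)

module _ {A : Set} where

  total-cong : ∀ {f g : A → ℚ} {xs} → All (λ x → f x ≡ g x) xs → total f xs ≡ total g xs
  total-cong f≡g = cong (foldr _+_ 0ℚ) (map-cong-local f≡g)

  total-cong-≗ : ∀ {f g : A → ℚ} → (∀ x → f x ≡ g x) → ∀ xs → total f xs ≡ total g xs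
  total-cong-≗ f≡g xs = cong (foldr _+_ 0ℚ) (map-cong f≡g xs)

  total-⊕ : ∀ (f g : A → ℚ) xs → total (λ x → f x + g x) xs ≡ total f xs + total g xs
  total-⊕ f g []       = refl
  total-⊕ f g (x ∷ xs) = trans (cong (f x + g x +_) (total-⊕ f g xs))
    (solve 4 (λ a b c d → a :+ b :+ (c :+ d) := (a :+ c) :+ (b :+ d)) refl
      (f x) (g x) (total f xs) (total g xs))

  total-· : ∀ c (f : A → ℚ) xs → total (λ x → c * f x) xs ≡ c * total f xs
  total-· c f []       = sym (ℚ.*-zeroʳ c)
  total-· c f (x ∷ xs) =
    trans (cong (c * f x +_) (total-· c f xs)) (sym (ℚ.*-distribˡ-+ c (f x) (total f xs)))

  total-++ : ∀ (f : A → ℚ) xs ys → total f (xs ++ ys) ≡ total f xs + total f ys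
  total-++ f []       ys = sym (ℚ.+-identityˡ _)
  total-++ f (x ∷ xs) ys = trans (cong (f x +_) (total-++ f xs ys)) (sym (ℚ.+-assoc (f x) _ _))

  total-map : ∀ {B : Set} (f : A → ℚ) (h : B → A) xs → total f (map h xs) ≡ total (λ x → f (h x)) xs
  total-map f h xs = cong (foldr _+_ 0ℚ) (sym (map-∘ xs))

  total-concatMap : ∀ {B : Set} (f : A → ℚ) (h : B → List A) xs →
                    total f (concatMap h xs) ≡ total (λ x → total f (h x)) xs
  total-concatMap f h []       = refl
  total-concatMap f h (x ∷ xs) =
    trans (total-++ f (h x) (concatMap h xs)) (cong (total f (h x) +_) (total-concatMap f h xs))

  total-1 : ∀ (xs : List A) → total (λ _ → 1ℚ) xs ≡ fromℕ (length xs)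
  total-1 []       = refl
  total-1 (x ∷ xs) = trans (cong (1ℚ +_) (total-1 xs)) (sym (fromℕ-suc (length xs)))

total-upTo-suc : ∀ f n → total f (upTo (suc n)) ≡ f 0 + total (tail f) (upTo n)
total-upTo-suc f n = cong (f 0 +_) (trans
  (cong (total f) (sym (map-upTo suc n))) (total-map f suc (upTo n)))

-- Products with series in powers of q^d.

x^ : ℕ → Series
x^ zero            = 𝟙
x^ (suc d) zero    = 0ℚ
x^ (suc d) (suc n) = x^ d n

x^-coeff-≡ : ∀ d → x^ d d ≡ 1ℚ
x^-coeff-≡ zero    = refl
x^-coeff-≡ (suc d) = x^-coeff-≡ d

x^-coeff-≢ : ∀ {d n} → n ≢ d → x^ d n ≡ 0ℚ
x^-coeff-≢ {zero}  {zero}  n≢d = contradiction refl n≢d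
x^-coeff-≢ {zero}  {suc n} n≢d = refl
x^-coeff-≢ {suc d} {zero}  n≢d = refl
x^-coeff-≢ {suc d} {suc n} n≢d = x^-coeff-≢ (λ n≡d → n≢d (cong suc n≡d))

x^-✶-< : ∀ {d n} f → n < d → (x^ d ✶ f) n ≡ 0ℚ
x^-✶-< {suc d} {zero}  f _         = ℚ.*-zeroˡ (f 0)
x^-✶-< {suc d} {suc n} f (s≤s n<d) =
  trans (cong₂ _+_ (ℚ.*-zeroˡ (f (suc n))) (x^-✶-< f n<d)) (ℚ.+-identityˡ 0ℚ)

x^-✶-+ : ∀ d n f → (x^ d ✶ f) (d ℕ.+ n) ≡ f n
x^-✶-+ zero    n f = ✶-identityˡ f n
x^-✶-+ (suc d) n f =
  trans (cong₂ _+_ (ℚ.*-zeroˡ (f (suc (d ℕ.+ n)))) (x^-✶-+ d n f)) (ℚ.+-identityˡ (f n))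

-- The product of Σₘ aₘ q^(md) with g.
multiples : (a : Series) (d : ℕ) .{{_ : NonZero d}} (g : Series) → Series
multiples a d g n = total (λ m → a m * g (n ∸ m ℕ.* d)) (upTo (suc (n / d)))

module _ (d : ℕ) .{{_ : NonZero d}} where

  multiples-< : ∀ a g {n} → n < d → multiples a d g n ≡ a 0 * g n
  multiples-< a g {n} n<d = trans
    (cong (λ k → total (λ m → a m * g (n ∸ m ℕ.* d)) (upTo (suc k))) (m<n⇒m/n≡0 n<d))
    (ℚ.+-identityʳ (a 0 * g n))

  multiples-+ : ∀ a g n → multiples a d g (d ℕ.+ n) ≡ a 0 * g (d ℕ.+ n) + multiples (tail a) d g n
  multiples-+ a g n = begin
    total term (upTo (suc ((d ℕ.+ n) / d)))
      ≡⟨ cong (λ k → total term (upTo (suc k))) quotient ⟩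
    total term (upTo (2 ℕ.+ n / d))
      ≡⟨ total-upTo-suc term (suc (n / d)) ⟩
    a 0 * g (d ℕ.+ n) + total (tail term) (upTo (suc (n / d)))
      ≡⟨ cong (a 0 * g (d ℕ.+ n) +_) (total-cong-≗
           (λ m → cong (λ k → a (suc m) * g k) (ℕ.[m+n]∸[m+o]≡n∸o d n (m ℕ.* d)))
           (upTo (suc (n / d)))) ⟩
    a 0 * g (d ℕ.+ n) + multiples (tail a) d g n ∎
    where
    term : Series
    term m = a m * g ((d ℕ.+ n) ∸ m ℕ.* d)
    quotient : (d ℕ.+ n) / d ≡ suc (n / d)
    quotient = trans (m/n≡1+[m∸n]/n (ℕ.m≤m+n d n)) (cong (λ k → suc (k / d)) (ℕ.m+n∸m≡n d n))

  -- Horner's scheme: the term m = 0 is split off and q^d factored out of the rest, which vanishes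
  -- below degree `d`.
  multiples-step : ∀ a g → multiples a d g ≈ a 0 · g ⊕ x^ d ✶ multiples (tail a) d g
  multiples-step a g n with n ℕ.<? d
  ... | yes n<d = trans (multiples-< a g n<d) (trans (sym (ℚ.+-identityʳ (a 0 * g n)))
                    (cong (a 0 * g n +_) (sym (x^-✶-< (multiples (tail a) d g) n<d))))
  ... | no n≮d  = subst (λ k → multiples a d g k ≡ (a 0 · g ⊕ x^ d ✶ multiples (tail a) d g) k)
                    (ℕ.m+[n∸m]≡n (ℕ.≮⇒≥ n≮d))
                    (trans (multiples-+ a g (n ∸ d)) (cong (a 0 * g (d ℕ.+ (n ∸ d)) +_)
                      (sym (x^-✶-+ d (n ∸ d) (multiples (tail a) d g)))))

  -- As `d` is positive, the Horner step refers back only to degree `n ∸ d`, so well-founded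
  -- induction leaves a single solution. Identities for `multiples` then need only one step checked.
  multiples-unique : ∀ {g} (V : Series → Series) →
    (∀ a → V a ≈ a 0 · g ⊕ x^ d ✶ V (tail a)) → ∀ a → V a ≈ multiples a d g
  multiples-unique {g} V step a n = go a (ℕ.<-wellFounded n)
    where
    go : ∀ a {n} → Acc _<_ n → V a n ≡ multiples a d g n
    go a {n} (acc rec) = trans (step a n) (trans (cong (a 0 * g n +_) shifted)
                           (sym (multiples-step a g n)))
      where
      shifted : (x^ d ✶ V (tail a)) n ≡ (x^ d ✶ multiples (tail a) d g) n
      shifted with n ℕ.<? d
      ... | yes n<d = trans (x^-✶-< (V (tail a)) n<d) (sym (x^-✶-< (multiples (tail a) d g) n<d))
      ... | no n≮d  = subst (λ k → (x^ d ✶ V (tail a)) k ≡ (x^ d ✶ multiples (tail a) d g) k)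
        (ℕ.m+[n∸m]≡n (ℕ.≮⇒≥ n≮d))
        (trans (x^-✶-+ d (n ∸ d) (V (tail a)))
        (trans (go (tail a) (rec (ℕ.∸-monoʳ-< (ℕ.>-nonZero⁻¹ d) (ℕ.≮⇒≥ n≮d))))
               (sym (x^-✶-+ d (n ∸ d) (multiples (tail a) d g)))))

  multiples-· : ∀ c a g → multiples (c · a) d g ≈ c · multiples a d g
  multiples-· c a g n = trans
    (total-cong-≗ (λ m → ℚ.*-assoc c (a m) (g (n ∸ m ℕ.* d))) (upTo (suc (n / d))))
    (total-· c (λ m → a m * g (n ∸ m ℕ.* d)) (upTo (suc (n / d))))

  multiples-congˡ : ∀ {a b} g → a ≈ b → multiples a d g ≈ multiples b d g
  multiples-congˡ g a≈b n =
    total-cong-≗ (λ m → cong (_* g (n ∸ m ℕ.* d)) (a≈b m)) (upTo (suc (n / d)))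

  multiples-congʳ : ∀ a {g h} → g ≈ h → multiples a d g ≈ multiples a d h
  multiples-congʳ a g≈h n =
    total-cong-≗ (λ m → cong (a m *_) (g≈h (n ∸ m ℕ.* d))) (upTo (suc (n / d)))

  -- Multiplying the Horner step for `g` by `L` gives the one for `L ✶ g`; uniqueness replaces
  -- rearranging double sums.
  multiples-✶ : ∀ L a g → multiples a d (L ✶ g) ≈ L ✶ multiples a d g
  multiples-✶ L a g = S.sym (multiples-unique (λ a → L ✶ multiples a d g) step a)
    where
    step : ∀ a → L ✶ multiples a d g ≈ a 0 · (L ✶ g) ⊕ x^ d ✶ (L ✶ multiples (tail a) d g)
    step a = S.trans (✶-cong {f = L} S.refl (multiples-step a g))
      (S.trans (S.distribˡ L (a 0 · g) (x^ d ✶ multiples (tail a) d g))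
      (S.+-cong
        (S.trans (✶-comm L (a 0 · g)) (S.trans (·-✶-assoc (a 0) g L)
          (λ n → cong (a 0 *_) (✶-comm g L n))))
        (x∙yz≈y∙xz L (x^ d) (multiples (tail a) d g))))

  -- The Leibniz rule termwise: the degree splits as n = md + (n - md), which truncated subtraction
  -- respects because m ≤ n / d.
  θ-multiples : ∀ a g →
    θ (multiples a d g) ≈ multiples (λ m → fromℕ (m ℕ.* d) * a m) d g ⊕ multiples a d (θ g)
  θ-multiples a g n = begin
    fromℕ n * total (λ m → a m * g (n ∸ m ℕ.* d)) (upTo (suc (n / d)))
      ≡⟨ total-· (fromℕ n) (λ m → a m * g (n ∸ m ℕ.* d)) (upTo (suc (n / d))) ⟨
    total (λ m → fromℕ n * (a m * g (n ∸ m ℕ.* d))) (upTo (suc (n / d)))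
      ≡⟨ total-cong (All.map (λ {m} → split m) (All.all-upTo (suc (n / d)))) ⟩
    total (λ m → fromℕ (m ℕ.* d) * a m * g (n ∸ m ℕ.* d) + a m * θ g (n ∸ m ℕ.* d)) (upTo (suc (n / d)))
      ≡⟨ total-⊕ (λ m → fromℕ (m ℕ.* d) * a m * g (n ∸ m ℕ.* d)) (λ m → a m * θ g (n ∸ m ℕ.* d))
           (upTo (suc (n / d))) ⟩
    multiples (λ m → fromℕ (m ℕ.* d) * a m) d g n + multiples a d (θ g) n ∎
    where
    split : ∀ m → m < suc (n / d) → fromℕ n * (a m * g (n ∸ m ℕ.* d)) ≡
            fromℕ (m ℕ.* d) * a m * g (n ∸ m ℕ.* d) + a m * θ g (n ∸ m ℕ.* d)
    split m (s≤s m≤) = trans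
      (cong (_* (a m * g (n ∸ m ℕ.* d))) (trans
        (cong fromℕ (sym (ℕ.m+[n∸m]≡n (ℕ.≤-trans (ℕ.*-monoˡ-≤ d m≤) (m/n*n≤m n d)))))
        (fromℕ-+ (m ℕ.* d) (n ∸ m ℕ.* d))))
      (solve 4 (λ s t a g → (s :+ t) :* (a :* g) := s :* a :* g :+ a :* (t :* g)) refl
        (fromℕ (m ℕ.* d)) (fromℕ (n ∸ m ℕ.* d)) (a m) (g (n ∸ m ℕ.* d)))

-- Generating series of weighted partitions.

partitions≤-bounded : ∀ k n → All (All (_≤ k)) (partitions≤ k n)
partitions≤-bounded zero    zero    = [] ∷ []
partitions≤-bounded zero    (suc n) = []
partitions≤-bounded (suc k) n       =
  All.concat⁺ (All.map⁺ (All.universal (λ m → All.map⁺ (All.map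
    (λ μ≤k → All.++⁺ (All.replicate⁺ m ℕ.≤-refl) (All.map ℕ.m≤n⇒m≤1+n μ≤k))
    (partitions≤-bounded k (n ∸ m ℕ.* suc k)))) (upTo (suc (n / suc k)))))

weightSeries : (List ℕ → ℚ) → ℕ → Series
weightSeries w k n = total w (partitions≤ k n)

-- Partitions are grouped by the multiplicity `m` of the part `k + 1`; a weight multiplicative
-- across that block pulls out `a m`.
weightSeries-suc : ∀ w a k →
  (∀ m {μ} → All (_≤ k) μ → w (replicate m (suc k) ++ μ) ≡ a m * w μ) →
  weightSeries w (suc k) ≈ multiples a (suc k) (weightSeries w k)
weightSeries-suc w a k factor n = trans
  (total-concatMap w (λ m → map (replicate m (suc k) ++_) (partitions≤ k (n ∸ m ℕ.* suc k)))
    (upTo (suc (n / suc k))))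
  (total-cong-≗ (λ m →
    trans (total-map w (replicate m (suc k) ++_) (partitions≤ k (n ∸ m ℕ.* suc k)))
    (trans (total-cong (All.map (factor m) (partitions≤-bounded k (n ∸ m ℕ.* suc k))))
           (total-· (a m) w (partitions≤ k (n ∸ m ℕ.* suc k)))))
    (upTo (suc (n / suc k))))

weightSeries-0 : ∀ w → w [] ≡ 1ℚ → weightSeries w 0 ≈ 𝟙
weightSeries-0 w w[]≡1 zero    = trans (ℚ.+-identityʳ (w [])) w[]≡1
weightSeries-0 w w[]≡1 (suc n) = refl

-- The Euler product and its inverse.

fromℤ-⊛ : ∀ f g n → fromℤ ((f ⊛ g) n) ≡ ((λ i → fromℤ (f i)) ✶ (λ i → fromℤ (g i))) n
fromℤ-⊛ f g zero    = trans (cong fromℤ (ℤ.+-identityʳ (f 0 ℤ.* g 0))) (fromℤ-* (f 0) (g 0))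
fromℤ-⊛ f g (suc n) = trans (fromℤ-+ (f 0 ℤ.* g (suc n)) (((λ i → f (suc i)) ⊛ g) n))
  (cong₂ _+_ (fromℤ-* (f 0) (g (suc n))) (fromℤ-⊛ (λ i → f (suc i)) g n))

fromℤ-q^ : ∀ d n → fromℤ (q^ d n) ≡ x^ d n
fromℤ-q^ zero    zero    = refl
fromℤ-q^ zero    (suc n) = refl
fromℤ-q^ (suc d) zero    = refl
fromℤ-q^ (suc d) (suc n) = fromℤ-q^ d n

fromℤ-^ˢ : ∀ f k n → fromℤ ((f ^ˢ k) n) ≡ ((λ i → fromℤ (f i)) ^ k) n
fromℤ-^ˢ f zero    n = fromℤ-q^ 0 n
fromℤ-^ˢ f (suc k) n = trans (fromℤ-⊛ f (f ^ˢ k) n)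
  (✶-cong {f = λ i → fromℤ (f i)} S.refl (fromℤ-^ˢ f k) n)

1-x^ : ℕ → Series
1-x^ d = 𝟙 ⊕ ⊝ x^ d

fromℤ-1-q^ : ∀ d n → fromℤ ((q^ 0 ⊖ q^ d) n) ≡ 1-x^ d n
fromℤ-1-q^ d n = trans (fromℤ-+ (q^ 0 n) (ℤ.- q^ d n))
  (cong₂ _+_ (fromℤ-q^ 0 n) (trans (fromℤ-neg (q^ d n)) (cong -_ (fromℤ-q^ d n))))

euler≤ : ℕ → ℕ → Series
euler≤ k N n = fromℤ (eulerProduct≤ k N n)

euler≤-suc : ∀ k N → euler≤ k (suc N) ≈ 1-x^ (suc N) ^ k ✶ euler≤ k N
euler≤-suc k N n = trans
  (fromℤ-⊛ ((q^ 0 ⊖ q^ (suc N)) ^ˢ k) (eulerProduct≤ k N) n)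
  (✶-cong {g = euler≤ k N}
    (λ i → trans (fromℤ-^ˢ (q^ 0 ⊖ q^ (suc N)) k i) (^-congˡ k (fromℤ-1-q^ (suc N)) i)) S.refl n)

count : List ℕ → ℚ
count _ = 1ℚ

𝟙^k≈𝟙 : ∀ k → 𝟙 ^ k ≈ 𝟙
𝟙^k≈𝟙 zero    = S.refl
𝟙^k≈𝟙 (suc k) = S.trans (✶-identityˡ (𝟙 ^ k)) (𝟙^k≈𝟙 k)

count-suc : ∀ k → weightSeries count (suc k) ≈ multiples (λ _ → 1ℚ) (suc k) (weightSeries count k)
count-suc k = weightSeries-suc count (λ _ → 1ℚ) k (λ _ _ → refl)

-- A geometric series: the constant sequence 1 is its own tail, so the Horner step reads M = Q + q^d
-- M.
1-x^-✶-count : ∀ k → 1-x^ (suc k) ✶ weightSeries count (suc k) ≈ weightSeries count k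
1-x^-✶-count k n = begin
  (1-x^ d ✶ Q′) n
    ≡⟨ ✶-cong {f = 1-x^ d} S.refl (count-suc k) n ⟩
  (1-x^ d ✶ M) n
    ≡⟨ ✶-distribʳ M 𝟙 (⊝ x^ d) n ⟩
  (𝟙 ✶ M) n + ((⊝ x^ d) ✶ M) n
    ≡⟨ cong₂ _+_ (trans (✶-identityˡ M n) (multiples-step d (λ _ → 1ℚ) Q n))
         (sym (-‿distribˡ-* (x^ d) M n)) ⟩
  1ℚ * Q n + (x^ d ✶ M) n - (x^ d ✶ M) n
    ≡⟨ solve 2 (λ g y → con 1ℚ :* g :+ y :+ :- y := g) refl (Q n) ((x^ d ✶ M) n) ⟩
  Q n ∎
  where
  d : ℕ
  d = suc k
  Q Q′ M : Series
  Q = weightSeries count k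
  Q′ = weightSeries count (suc k)
  M = multiples (λ _ → 1ℚ) d Q

-- Telescoping: the factor for `N + 1` lowers the largest admissible part to `N`, with `^-distrib-*`
-- passing to k-th powers.
euler≤-inverse : ∀ k N → euler≤ k N ✶ weightSeries count N ^ k ≈ 𝟙
euler≤-inverse k zero    = S.trans
  (✶-cong (fromℤ-q^ 0) (S.trans (^-congˡ k (weightSeries-0 count refl)) (𝟙^k≈𝟙 k)))
  (✶-identityˡ 𝟙)
euler≤-inverse k (suc N) =
  S.trans (✶-cong {g = Q′ ^ k} (euler≤-suc k N) S.refl)
  (S.trans (xy∙z≈y∙xz (B ^ k) E (Q′ ^ k))
  (S.trans (✶-cong {f = E} S.refl
    (S.trans (S.sym (^-distrib-* B Q′ k)) (^-congˡ k (1-x^-✶-count N))))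
  (euler≤-inverse k N)))
  where
  B E Q′ : Series
  B = 1-x^ (suc N)
  E = euler≤ k N
  Q′ = weightSeries count (suc N)

^-cong≤ : ∀ n {f g} → (∀ {i} → i ≤ n → f i ≡ g i) → ∀ k {i} → i ≤ n → (f ^ k) i ≡ (g ^ k) i
^-cong≤ n f≡g zero    i≤n = refl
^-cong≤ n f≡g (suc k) {i} i≤n = ✶-cong≤ i (λ j≤i → f≡g (ℕ.≤-trans j≤i i≤n))
  (λ j≤i → ^-cong≤ n f≡g k (ℕ.≤-trans j≤i i≤n))

P : Series
P n = fromℕ (p n)

-- A part larger than `n` can only have multiplicity 0 in degree `n`.
count-stable : ∀ {n N} → n ≤ N → weightSeries count N n ≡ P n
count-stable {n} n≤N = go (ℕ.≤⇒≤′ n≤N)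
  where
  go : ∀ {N} → n ℕ.≤′ N → weightSeries count N n ≡ P n
  go ℕ.≤′-refl             = total-1 (partitions n)
  go {suc N} (ℕ.≤′-step n≤′N) = trans (count-suc N n)
    (trans (multiples-< (suc N) (λ _ → 1ℚ) (weightSeries count N) (s≤s (ℕ.≤′⇒≤ n≤′N)))
    (trans (ℚ.*-identityˡ _) (go n≤′N)))

-- Up to degree `n` both factors agree with their truncations at `N = n`.
euler-inverse : ∀ k → (λ n → fromℤ (eulerProduct k n)) ✶ P ^ k ≈ 𝟙
euler-inverse k n = trans
  (✶-cong≤ n (λ i≤n → cong fromℤ (sym (eulerProduct-stable k i≤n)))
             (^-cong≤ n (λ i≤n → sym (count-stable i≤n)) k))
  (euler≤-inverse k n n)

fromℤ-q-⊛ : ∀ f n → fromℤ ((q^ 1 ⊛ f) (suc n)) ≡ fromℤ (f n)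
fromℤ-q-⊛ f n = trans (fromℤ-⊛ (q^ 1) f (suc n))
  (trans (✶-cong {g = λ i → fromℤ (f i)} (fromℤ-q^ 1) S.refl (suc n))
         (x^-✶-+ 1 n (λ i → fromℤ (f i))))

-- The leading q in `τ` cancels against the index shift in `T`.
T≈euler : T ≈ λ n → fromℤ (eulerProduct 24 n)
T≈euler = fromℤ-q-⊛ (eulerProduct 24)

T-inverse : T ✶ P ^ 24 ≈ 𝟙
T-inverse = S.trans (✶-cong {g = P ^ 24} T≈euler S.refl) (euler-inverse 24)

-- Logarithmic derivatives of powers and inverses.

θ-𝟙 : θ 𝟙 ≈ 𝟘
θ-𝟙 zero    = refl
θ-𝟙 (suc n) = ℚ.*-zeroʳ (fromℕ (suc n))

logDerivative-^ : ∀ {L g} → θ g ≈ L ✶ g → ∀ k → θ (g ^ k) ≈ (fromℕ k · L) ✶ g ^ k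
logDerivative-^ {L} {g} θg zero    n =
  trans (θ-𝟙 n) (sym (trans (·-✶-assoc 0ℚ L 𝟙 n) (ℚ.*-zeroˡ ((L ✶ 𝟙) n))))
logDerivative-^ {L} {g} θg (suc k) n = begin
  θ (g ✶ G) n
    ≡⟨ θ-✶ g G n ⟩
  (θ g ✶ G) n + (g ✶ θ G) n
    ≡⟨ cong₂ _+_ (S.trans (✶-cong {g = G} θg S.refl) (✶-assoc L g G) n)
                 (✶-cong {f = g} S.refl (logDerivative-^ θg k) n) ⟩
  X + (g ✶ ((fromℕ k · L) ✶ G)) n
    ≡⟨ cong (X +_) (trans (x∙yz≈y∙xz g (fromℕ k · L) G n) (·-✶-assoc (fromℕ k) L (g ✶ G) n)) ⟩
  X + fromℕ k * X
    ≡⟨ solve 2 (λ s x → x :+ s :* x := (con 1ℚ :+ s) :* x) refl (fromℕ k) X ⟩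
  (1ℚ + fromℕ k) * X
    ≡⟨ cong (_* X) (fromℕ-suc k) ⟨
  fromℕ (suc k) * X
    ≡⟨ ·-✶-assoc (fromℕ (suc k)) L (g ✶ G) n ⟨
  ((fromℕ (suc k) · L) ✶ g ^ suc k) n ∎
  where
  G : Series
  G = g ^ k
  X : ℚ
  X = (L ✶ (g ✶ G)) n

module _ (f g : Series) (k : ℕ) (inverse : f ✶ g ^ suc k ≈ 𝟙) where

  -- Since `f ✶ g ^ suc k` is 1, `f ✶ g ^ k` is the inverse of `g`; this is θg / g without division.
  logDerivative : Series
  logDerivative = θ g ✶ (f ✶ g ^ k)

  private
    L : Series
    L = logDerivative

    L0≡0 : L 0 ≡ 0ℚ
    L0≡0 = trans (cong (_* (f ✶ g ^ k) 0) (ℚ.*-zeroˡ (g 0))) (ℚ.*-zeroˡ ((f ✶ g ^ k) 0))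

  logDerivative-base : IsLogDerivative logDerivative g
  logDerivative-base = record
    { vanish = L0≡0
    ; deriv  = S.sym (S.trans (✶-assoc (θ g) (f ✶ g ^ k) g)
        (S.trans (✶-cong {f = θ g} S.refl
          (S.trans (✶-assoc f (g ^ k) g)
          (S.trans (✶-cong {f = f} S.refl (✶-comm (g ^ k) g)) inverse)))
        (S.*-identityʳ (θ g)))) }

  -- Differentiating f G = 1 for G = g^(k+1) gives θf G = - f θG = - (k+1) L; multiplying by `f`
  -- cancels G.
  logDerivative-inverse : IsLogDerivative (⊝ (fromℕ (suc k) · logDerivative)) f
  logDerivative-inverse = record
    { vanish = trans (cong (λ l → - (fromℕ (suc k) * l)) L0≡0) (cong -_ (ℚ.*-zeroʳ (fromℕ (suc k))))
    ; deriv  = S.trans (S.sym (S.*-identityʳ (θ f)))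
        (S.trans (✶-cong {f = θ f} S.refl (S.sym inverse))
        (S.trans (x∙yz≈xz∙y (θ f) f G)
        (✶-cong {g = f} θf✶G S.refl))) }
    where
    G M : Series
    G = g ^ suc k
    M = fromℕ (suc k) · L
    f✶θG : f ✶ θ G ≈ M
    f✶θG = S.trans (✶-cong {f = f} S.refl (logDerivative-^ (IsLogDerivative.deriv logDerivative-base) (suc k)))
      (S.trans (x∙yz≈y∙xz f M G) (S.trans (✶-cong {f = M} S.refl inverse) (S.*-identityʳ M)))
    θf✶G : θ f ✶ G ≈ ⊝ M
    θf✶G = inverseˡ-unique (θ f ✶ G) M (S.trans (S.+-cong {x = θ f ✶ G} S.refl (S.sym f✶θG))
      (S.trans (S.sym (θ-✶ f G)) (S.trans (λ n → cong (fromℕ n *_) (inverse n)) θ-𝟙)))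

-- Multiplicativity of z_λ.

recip-* : ∀ a b c .{{_ : NonZero a}} .{{_ : NonZero b}} .{{_ : NonZero c}} →
          c ≡ a ℕ.* b → recip c ≡ recip a * recip b
recip-* a b c c≡ab = fromℕ-cancelˡ c (begin
  fromℕ c * recip c
    ≡⟨ fromℕ-*-recip c ⟩
  1ℚ * 1ℚ
    ≡⟨ cong₂ _*_ (fromℕ-*-recip a) (fromℕ-*-recip b) ⟨
  fromℕ a * recip a * (fromℕ b * recip b)
    ≡⟨ solve 4 (λ a r b s → a :* r :* (b :* s) := a :* b :* (r :* s)) refl
         (fromℕ a) (recip a) (fromℕ b) (recip b) ⟩
  fromℕ a * fromℕ b * (recip a * recip b)
    ≡⟨ cong (_* (recip a * recip b)) (trans (cong fromℕ c≡ab) (fromℕ-* a b)) ⟨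
  fromℕ c * (recip a * recip b) ∎)

multiplicity-absent : ∀ {k μ} → All (_≢ k) μ → multiplicity k μ ≡ 0
multiplicity-absent []                      = refl
multiplicity-absent {k} {x ∷ μ} (x≢k ∷ μ≢k)
  rewrite dec-false (x ℕ.≟ k) x≢k = multiplicity-absent μ≢k

multiplicity-++-≢ : ∀ {k ν} μ → All (_≢ k) ν → multiplicity k (ν ++ μ) ≡ multiplicity k μ
multiplicity-++-≢ μ []                      = refl
multiplicity-++-≢ {k} {x ∷ ν} μ (x≢k ∷ ν≢k)
  rewrite dec-false (x ℕ.≟ k) x≢k = multiplicity-++-≢ μ ν≢k

multiplicity-replicate-++ : ∀ k m μ → multiplicity k (replicate m k ++ μ) ≡ m ℕ.+ multiplicity k μ
multiplicity-replicate-++ k zero    μ = refl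
multiplicity-replicate-++ k (suc m) μ
  rewrite dec-true (k ℕ.≟ k) refl = cong suc (multiplicity-replicate-++ k m μ)

zFactor : List ℕ → ℕ → ℕ
zFactor μ k = k ℕ.^ multiplicity k μ ℕ.* multiplicity k μ !

-- The range of the product in `z μ` varies with `sum μ`; a bound free of `μ` makes different
-- partitions comparable factor by factor.
z≤ : ℕ → List ℕ → ℕ
z≤ K μ = product (map (zFactor μ) (map suc (upTo K)))

z≤-suc : ∀ K μ → z≤ (suc K) μ ≡ z≤ K μ ℕ.* zFactor μ (suc K)
z≤-suc K μ = begin
  product (map (zFactor μ) (map suc (upTo (suc K))))
    ≡⟨ cong (λ l → product (map (zFactor μ) (map suc l))) (upTo-∷ʳ K) ⟨
  product (map (zFactor μ) (map suc (upTo K ++ K ∷ [])))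
    ≡⟨ cong product (trans (cong (map (zFactor μ)) (map-++ suc (upTo K) (K ∷ [])))
                           (map-++ (zFactor μ) (map suc (upTo K)) (suc K ∷ []))) ⟩
  product (map (zFactor μ) (map suc (upTo K)) ++ zFactor μ (suc K) ∷ [])
    ≡⟨ product-++ (map (zFactor μ) (map suc (upTo K))) (zFactor μ (suc K) ∷ []) ⟩
  z≤ K μ ℕ.* (zFactor μ (suc K) ℕ.* 1)
    ≡⟨ cong (z≤ K μ ℕ.*_) (ℕ.*-identityʳ (zFactor μ (suc K))) ⟩
  z≤ K μ ℕ.* zFactor μ (suc K) ∎

z≤-extend : ∀ {K μ} → All (_≤ K) μ → ∀ j → z≤ (j ℕ.+ K) μ ≡ z≤ K μ
z≤-extend         μ≤K zero    = refl
z≤-extend {K} {μ} μ≤K (suc j) = begin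
  z≤ (suc j ℕ.+ K) μ
    ≡⟨ z≤-suc (j ℕ.+ K) μ ⟩
  z≤ (j ℕ.+ K) μ ℕ.* zFactor μ (suc j ℕ.+ K)
    ≡⟨ cong₂ (λ a m → a ℕ.* ((suc j ℕ.+ K) ℕ.^ m ℕ.* m !)) (z≤-extend μ≤K j)
         (multiplicity-absent (All.map (λ x≤K → ℕ.<⇒≢ (s≤s (ℕ.m≤n⇒m≤o+n j x≤K))) μ≤K)) ⟩
  z≤ K μ ℕ.* 1
    ≡⟨ ℕ.*-identityʳ (z≤ K μ) ⟩
  z≤ K μ ∎

parts≤sum : ∀ μ → All (_≤ sum μ) μ
parts≤sum []      = []
parts≤sum (x ∷ μ) = ℕ.m≤m+n x (sum μ) ∷ All.map (ℕ.m≤n⇒m≤o+n x) (parts≤sum μ)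

z-bounded : ∀ {K} μ → All (_≤ K) μ → z μ ≡ z≤ K μ
z-bounded {K} μ μ≤K = begin
  -- `K` and `sum μ` may compare either way, so both bounds are raised to their sum.
  z≤ (sum μ) μ          ≡⟨ z≤-extend (parts≤sum μ) K ⟨
  z≤ (K ℕ.+ sum μ) μ    ≡⟨ cong (λ k → z≤ k μ) (ℕ.+-comm K (sum μ)) ⟩
  z≤ (sum μ ℕ.+ K) μ    ≡⟨ z≤-extend μ≤K (sum μ) ⟩
  z≤ K μ                ∎

z-block : ℕ → ℕ → ℕ
z-block d m = d ℕ.^ m ℕ.* m !

z-block-nonZero : ∀ d m .{{_ : NonZero d}} → NonZero (z-block d m)
z-block-nonZero d m = ℕ.m*n≢0 (d ℕ.^ m) (m !) {{ℕ.m^n≢0 d m}} {{m ℕ.!≢0}}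

-- Copies of `k + 1` do not affect smaller multiplicities, and `μ` has no part `k + 1`: the lower
-- factors come from `μ` alone, the top one from the block alone.
z-replicate-++ : ∀ k m {μ} → All (_≤ k) μ →
                 z (replicate m (suc k) ++ μ) ≡ z-block (suc k) m ℕ.* z μ
z-replicate-++ k m {μ} μ≤k = begin
  z ν
    ≡⟨ z-bounded ν (All.++⁺ (All.replicate⁺ m ℕ.≤-refl) (All.map ℕ.m≤n⇒m≤1+n μ≤k)) ⟩
  z≤ (suc k) ν
    ≡⟨ z≤-suc k ν ⟩
  z≤ k ν ℕ.* zFactor ν (suc k)
    ≡⟨ cong₂ (λ a m → a ℕ.* z-block (suc k) m) (prefix k ℕ.≤-refl)
         (trans (multiplicity-replicate-++ (suc k) m μ)
         (trans (cong (m ℕ.+_) (multiplicity-absent (All.map (λ x≤k → ℕ.<⇒≢ (s≤s x≤k)) μ≤k)))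
                (ℕ.+-identityʳ m))) ⟩
  z≤ k μ ℕ.* z-block (suc k) m
    ≡⟨ cong (ℕ._* z-block (suc k) m) (z-bounded μ μ≤k) ⟨
  z μ ℕ.* z-block (suc k) m
    ≡⟨ ℕ.*-comm (z μ) (z-block (suc k) m) ⟩
  z-block (suc k) m ℕ.* z μ ∎
  where
  ν : List ℕ
  ν = replicate m (suc k) ++ μ
  prefix : ∀ K → K ≤ k → z≤ K ν ≡ z≤ K μ
  prefix zero    _   = refl
  prefix (suc K) K<k = trans (z≤-suc K ν) (trans
    (cong₂ (λ a m → a ℕ.* z-block (suc K) m) (prefix K (ℕ.<⇒≤ K<k))
      (multiplicity-++-≢ μ (All.replicate⁺ m (ℕ.>⇒≢ (s≤s K<k)))))
    (sym (z≤-suc K μ)))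

-- Partition weights and exponential series.

module _ (ψ : ℕ → ℚ) where

  ψ[_] : List ℕ → ℚ
  ψ[ μ ] = foldr ℚ._*_ 1ℚ (map ψ μ)

  weight : List ℕ → ℚ
  weight μ = z⁻¹ μ * ψ[ μ ]

  -- The coefficients of exp(ψ_d x / d).
  expCoeff : (d : ℕ) .{{_ : NonZero d}} → Series
  expCoeff d m = recip (z-block d m) {{z-block-nonZero d m}} * ψ d ℚΣ.^ m

  ψ-replicate-++ : ∀ d m μ → ψ[ replicate m d ++ μ ] ≡ ψ d ℚΣ.^ m * ψ[ μ ]
  ψ-replicate-++ d zero    μ = sym (ℚ.*-identityˡ ψ[ μ ])
  ψ-replicate-++ d (suc m) μ =
    trans (cong (ψ d *_) (ψ-replicate-++ d m μ)) (sym (ℚ.*-assoc (ψ d) (ψ d ℚΣ.^ m) ψ[ μ ]))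

  weight-replicate-++ : ∀ k m {μ} → All (_≤ k) μ →
                        weight (replicate m (suc k) ++ μ) ≡ expCoeff (suc k) m * weight μ
  weight-replicate-++ k m {μ} μ≤k = trans
    (cong₂ _*_ (recip-* (z-block (suc k) m) (z μ) (z (replicate m (suc k) ++ μ))
                  {{z-block-nonZero (suc k) m}} {{z-nonZero μ}} {{z-nonZero (replicate m (suc k) ++ μ)}}
                  (z-replicate-++ k m μ≤k))
               (ψ-replicate-++ (suc k) m μ))
    (solve 4 (λ a b c d → a :* b :* (c :* d) := a :* c :* (b :* d)) refl
      (recip (z-block (suc k) m) {{z-block-nonZero (suc k) m}}) (z⁻¹ μ) (ψ (suc k) ℚΣ.^ m) ψ[ μ ])

  -- `z-block d (suc m)` is (m+1)d times `z-block d m`, which cancels the factor in front. This is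
  -- the differential equation of exp(ψ_d q^d / d), coefficient by coefficient.
  expCoeff-deriv : ∀ d .{{_ : NonZero d}} m →
                   fromℕ (suc m ℕ.* d) * expCoeff d (suc m) ≡ ψ d * expCoeff d m
  expCoeff-deriv d m = begin
    fromℕ a * (recip (z-block d (suc m)) {{nz′}} * (ψ d * ψ d ℚΣ.^ m))
      ≡⟨ cong (λ r → fromℕ a * (r * (ψ d * ψ d ℚΣ.^ m)))
           (recip-* a (z-block d m) (z-block d (suc m)) {{nz-a}} {{nz}} {{nz′}} block-suc) ⟩
    fromℕ a * (recip a {{nz-a}} * r * (ψ d * ψ d ℚΣ.^ m))
      ≡⟨ solve 5 (λ a b r s t → a :* (b :* r :* (s :* t)) := a :* b :* (s :* (r :* t))) refl
           (fromℕ a) (recip a {{nz-a}}) r (ψ d) (ψ d ℚΣ.^ m) ⟩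
    fromℕ a * recip a {{nz-a}} * (ψ d * expCoeff d m)
      ≡⟨ cong (_* (ψ d * expCoeff d m)) (fromℕ-*-recip a {{nz-a}}) ⟩
    1ℚ * (ψ d * expCoeff d m)
      ≡⟨ ℚ.*-identityˡ (ψ d * expCoeff d m) ⟩
    ψ d * expCoeff d m ∎
    where
    a : ℕ
    a = suc m ℕ.* d
    nz : NonZero (z-block d m)
    nz = z-block-nonZero d m
    nz′ : NonZero (z-block d (suc m))
    nz′ = z-block-nonZero d (suc m)
    nz-a : NonZero a
    nz-a = ℕ.m*n≢0 (suc m) d
    r : ℚ
    r = recip (z-block d m) {{nz}}
    block-suc : z-block d (suc m) ≡ a ℕ.* z-block d m
    block-suc = ℕ-solve 4 (λ d e s f → (d ℕ:* e) ℕ:* (s ℕ:* f) ℕ:= (s ℕ:* d) ℕ:* (e ℕ:* f)) refl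
      d (d ℕ.^ m) (suc m) (m !)

  -- The logarithmic derivative of the product of exp(ψ_d q^d / d) over d ≤ k.
  truncation : ℕ → Series
  truncation zero    = 𝟘
  truncation (suc k) = ψ (suc k) · x^ (suc k) ⊕ truncation k

  truncation-< : ∀ {k n} → k < n → truncation k n ≡ 0ℚ
  truncation-< {zero}  _   = refl
  truncation-< {suc k} k<n = trans
    (cong₂ _+_ (trans (cong (ψ (suc k) *_) (x^-coeff-≢ (ℕ.>⇒≢ k<n))) (ℚ.*-zeroʳ (ψ (suc k))))
               (truncation-< (ℕ.<-trans (ℕ.n<1+n k) k<n)))
    (ℚ.+-identityˡ 0ℚ)

  truncation-0 : ∀ k → truncation k 0 ≡ 0ℚ
  truncation-0 zero    = refl
  truncation-0 (suc k) =
    trans (cong₂ _+_ (ℚ.*-zeroʳ (ψ (suc k))) (truncation-0 k)) (ℚ.+-identityˡ 0ℚ)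

  truncation-≤ : ∀ {k n} → suc n ≤ k → truncation k (suc n) ≡ ψ (suc n)
  truncation-≤ {suc k} {n} n<1+k with n ℕ.≟ k
  ... | yes refl = trans
    (cong₂ _+_ (trans (cong (ψ (suc n) *_) (x^-coeff-≡ n)) (ℚ.*-identityʳ (ψ (suc n))))
               (truncation-< (ℕ.n<1+n n)))
    (ℚ.+-identityʳ (ψ (suc n)))
  ... | no n≢k = trans
    (cong₂ _+_ (trans (cong (ψ (suc k) *_) (x^-coeff-≢ n≢k)) (ℚ.*-zeroʳ (ψ (suc k))))
               (truncation-≤ (ℕ.≤∧≢⇒< (ℕ.≤-pred n<1+k) n≢k)))
    (ℚ.+-identityˡ (ψ (suc n)))

  weight-suc : ∀ k → weightSeries weight (suc k) ≈
                     multiples (expCoeff (suc k)) (suc k) (weightSeries weight k)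
  weight-suc k = weightSeries-suc weight (expCoeff (suc k)) k (weight-replicate-++ k)

  weightSeries-at-0 : ∀ k → weightSeries weight k 0 ≡ 1ℚ
  weightSeries-at-0 zero    = refl
  weightSeries-at-0 (suc k) = begin
    weightSeries weight (suc k) 0
      ≡⟨ weight-suc k 0 ⟩
    multiples (expCoeff (suc k)) (suc k) (weightSeries weight k) 0
      ≡⟨ multiples-< (suc k) (expCoeff (suc k)) (weightSeries weight k) (s≤s z≤n) ⟩
    1ℚ * weightSeries weight k 0
      ≡⟨ cong (1ℚ *_) (weightSeries-at-0 k) ⟩
    1ℚ ∎

  -- Induction on the largest part: the derivation hits either the new exponential, giving ψ_d q^d
  -- (`head`), or the series for smaller parts, giving `truncation k`.
  θ-weightSeries : ∀ k → θ (weightSeries weight k) ≈ truncation k ✶ weightSeries weight k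
  θ-weightSeries zero    = S.trans (λ n → cong (fromℕ n *_) (weightSeries-0 weight refl n))
    (S.trans θ-𝟙 (S.sym (✶-zeroˡ (weightSeries weight 0))))
  θ-weightSeries (suc k) n = begin
    fromℕ n * W′ n
      ≡⟨ cong (fromℕ n *_) (weight-suc k n) ⟩
    θ (multiples a d W) n
      ≡⟨ θ-multiples d a W n ⟩
    multiples b d W n + multiples a d (θ W) n
      ≡⟨ cong₂ _+_ (head n) (trans (multiples-congʳ d a (θ-weightSeries k) n)
                                   (multiples-✶ d (truncation k) a W n)) ⟩
    ((ψ d · x^ d) ✶ multiples a d W) n + (truncation k ✶ multiples a d W) n
      ≡⟨ ✶-distribʳ (multiples a d W) (ψ d · x^ d) (truncation k) n ⟨
    (truncation (suc k) ✶ multiples a d W) n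
      ≡⟨ ✶-cong {f = truncation (suc k)} S.refl (weight-suc k) n ⟨
    (truncation (suc k) ✶ W′) n ∎
    where
    d : ℕ
    d = suc k
    W W′ a b : Series
    W = weightSeries weight k
    W′ = weightSeries weight (suc k)
    a = expCoeff d
    b m = fromℕ (m ℕ.* d) * a m
    head : multiples b d W ≈ (ψ d · x^ d) ✶ multiples a d W
    head n = begin
      multiples b d W n
        ≡⟨ multiples-step d b W n ⟩
      0ℚ * a 0 * W n + (x^ d ✶ multiples (tail b) d W) n
        -- The m = 0 coefficient of `b` carries `fromℕ 0` and drops out; `expCoeff-deriv` turns
        -- `tail b` into `ψ d · a`.
        ≡⟨ cong₂ _+_ (solve 2 (λ a w → con 0ℚ :* a :* w := con 0ℚ) refl (a 0) (W n))
             (✶-cong {f = x^ d} S.refl (S.trans (multiples-congˡ d W (expCoeff-deriv d))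
               (multiples-· d (ψ d) a W)) n) ⟩
      0ℚ + (x^ d ✶ (ψ d · multiples a d W)) n
        ≡⟨ ℚ.+-identityˡ _ ⟩
      (x^ d ✶ (ψ d · multiples a d W)) n
        ≡⟨ ✶-comm (x^ d) (ψ d · multiples a d W) n ⟩
      ((ψ d · multiples a d W) ✶ x^ d) n
        ≡⟨ ·-✶-assoc (ψ d) (multiples a d W) (x^ d) n ⟩
      ψ d * (multiples a d W ✶ x^ d) n
        ≡⟨ cong (ψ d *_) (✶-comm (multiples a d W) (x^ d) n) ⟩
      ψ d * (x^ d ✶ multiples a d W) n
        ≡⟨ ·-✶-assoc (ψ d) (x^ d) (multiples a d W) n ⟨
      ((ψ d · x^ d) ✶ multiples a d W) n ∎

  weightSeries-isLogDerivative : ∀ k → IsLogDerivative (truncation k) (weightSeries weight k)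
  weightSeries-isLogDerivative k = record { vanish = truncation-0 k ; deriv = θ-weightSeries k }

-- The logarithmic derivative of the partition series, and the theorem.

-1^-square : ∀ n → (-1^ n) * (-1^ n) ≡ 1ℚ
-1^-square zero    = refl
-1^-square (suc n) = trans
  (solve 1 (λ s → con (- 1ℚ) :* s :* (con (- 1ℚ) :* s) := s :* s) refl (-1^ n)) (-1^-square n)

-- The exponent 24 in `T-inverse` is `suc 23`, so 1/P is `T ✶ P ^ 23`.
L : Series
L = logDerivative T P 23 T-inverse

P-logDerivative : IsLogDerivative L P
P-logDerivative = logDerivative-base T P 23 T-inverse

T-logDerivative : IsLogDerivative (⊝ (fromℕ 24 · L)) T
T-logDerivative = logDerivative-inverse T P 23 T-inverse

-- `det-H` for `T` yields -24 L up to sign; the sign and the 1/24 in `φ` undo both.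
φ≡L : ∀ n → φ (suc n) ≡ L (suc n)
φ≡L n = begin
  (-1^ suc n) * recip 24 * det (H (suc n) T)
    -- `T≈euler 0` proves `T 0 ≡ 1ℚ`: the constant term of the Euler product computes to 1.
    ≡⟨ cong ((-1^ suc n) * recip 24 *_) (det-H (T≈euler 0) T-logDerivative n) ⟩
  (- 1ℚ) * (-1^ n) * recip 24 * ((-1^ n) * - (fromℕ 24 * L (suc n)))
    ≡⟨ solve 4 (λ s c e l → con (- 1ℚ) :* s :* c :* (s :* :- (e :* l)) := s :* s :* (e :* c :* l)) refl
         (-1^ n) (recip 24) (fromℕ 24) (L (suc n)) ⟩
  (-1^ n) * (-1^ n) * (fromℕ 24 * recip 24 * L (suc n))
    ≡⟨ cong₂ (λ x y → x * (y * L (suc n))) (-1^-square n) (fromℕ-*-recip 24) ⟩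
  1ℚ * (1ℚ * L (suc n))
    ≡⟨ trans (ℚ.*-identityˡ _) (ℚ.*-identityˡ _) ⟩
  L (suc n) ∎

theorem3p6 : (n : ℕ) → 1 ≤ n →
    (fromℕ (n !) * fromℕ (p n) ≡ det (J n φ))
    × (φ n ≡ (-1^ (n ∸ 1)) * det (H n (λ i → fromℕ (p i))))
    × (fromℕ (p n) ≡ sumOverPartitions n (λ μ → z⁻¹ μ * φ[ μ ]))
theorem3p6 (suc n) _ =
    -- Here `refl` is p(0) = 1.
    sym (det-J refl P-logDerivative φ φ≡L n)
  , (begin
      φ (suc n)
        ≡⟨ φ≡L n ⟩
      L (suc n)
        ≡⟨ ℚ.*-identityˡ (L (suc n)) ⟨
      1ℚ * L (suc n)
        ≡⟨ cong (_* L (suc n)) (-1^-square n) ⟨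
      (-1^ n) * (-1^ n) * L (suc n)
        ≡⟨ ℚ.*-assoc (-1^ n) (-1^ n) (L (suc n)) ⟩
      (-1^ n) * ((-1^ n) * L (suc n))
        ≡⟨ cong ((-1^ n) *_) (det-H refl P-logDerivative n) ⟨
      (-1^ n) * det (H (suc n) P) ∎)
  -- With part bound and degree both `suc n`, the coefficient of `weightSeries` unfolds to the sum
  -- over all partitions of `suc n`.
  , logDerivative-unique (sym (weightSeries-at-0 φ (suc n))) P-logDerivative
      (weightSeries-isLogDerivative φ (suc n)) (suc n) L≡truncation ℕ.≤-refl
  where
  L≡truncation : ∀ {i} → i ≤ suc n → L i ≡ truncation φ (suc n) i
  L≡truncation {zero}  _   = trans (IsLogDerivative.vanish P-logDerivative)
                                   (sym (truncation-0 φ (suc n)))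
  L≡truncation {suc i} i≤n = trans (sym (φ≡L i)) (sym (truncation-≤ φ i≤n))
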